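{- Let $g,h:\mathbb{N}\to\mathbb{C}$ be arbitrary functions, let $f:\mathbb{N}^2\to\mathbb{C}$ be given by $$f(k,n)=\sum_{d\mid \gcd(k,n)} g(d)h(n/d)\qquad (k,n\in\mathbb{N}),$$ let $r\in\mathbb{N}$, and for $m_1,\ldots,m_r\in\mathbb{N}$ with $m=\operatorname{lcm}[m_1,\ldots,m_r]$ let $$F_f(m_1,\ldots,m_r)= \frac1{m} \sum_{k=1}^m f(k,m_1)\cdots f(k,m_r).$$ Then: (i) For all $m_1,\ldots,m_r\in\mathbb{N}$, with $m=\operatorname{lcm}[m_1,\ldots,m_r]$, $F_f$ has the representations $$F_f(m_1,\ldots,m_r)= \sum_{d_1\mid m_1, \ldots, d_r\mid m_r} \frac{g(d_1)\cdots g(d_r)}{\operatorname{lcm}[d_1,\ldots, d_r]}\, h(m_1/d_1)\cdots h(m_r/d_r),$$ $$F_f(m_1,\ldots,m_r)= \frac1{m} \sum_{d\mid m} f(d,m_1) \cdots f(d,m_r)\, \phi(m/d).$$ (ii) If $g$ and $h$ are multiplicative functions, then $F_f$ is multiplicative as a function of $r$ variables.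
   Context: $\mathbb{N}=\{1,2,\ldots\}$. $\phi$ is Euler's totient function. A function $F:\mathbb{N}^r\to\mathbb{C}$ is called multiplicative (as a function of several variables; for $r=1$ this is the usual notion) if it is not identically zero and $F(m_1n_1,\ldots,m_rn_r)=F(m_1,\ldots,m_r)F(n_1,\ldots,n_r)$ for all $m_1,\ldots,m_r,n_1,\ldots,n_r\in\mathbb{N}$ with $\gcd(m_1\cdots m_r,\,n_1\cdots n_r)=1$. -}

module Defs where

open import Algebra.Bundles using (CommutativeRing)
import Algebra.Properties.CommutativeMonoid.Sum as Sum
open import Data.Fin.Base using (Fin; zero; suc)
open import Data.Fin.Properties using (∀-cons)
import Data.Integer.Base as ℤ
open import Data.List.Base as List
  using (List; []; _∷_; upTo; length; filter; mapMaybe; cartesianProductWith)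
import Data.Maybe.Base as Maybe
open import Data.Nat.Base as ℕ using (ℕ; NonZero)
open import Data.Nat.Coprimality using (coprime?)
import Data.Nat.Divisibility as ∣
import Data.Nat.DivMod as DivMod
import Data.Nat.GCD as GCD
import Data.Nat.LCM as LCM
import Data.Nat.Properties as ℕₚ
open import Data.Product.Base using (∃; _×_; _,_; proj₁; proj₂)
open import Data.Rational.Base as ℚ using (ℚ; 0ℚ; 1ℚ; ½; Positive; positive)
import Data.Rational.Properties as ℚₚ
open import Data.Rational.Solver using (module +-*-Solver)
open import Data.Sum.Base using (inj₁; inj₂)
import Data.Vec.Functional as Vector
open import Function.Base using (_∘_)
open import Level using (0ℓ)
open import Relation.Binary.PropositionalEquality
  using (_≡_; refl; sym; trans; cong; subst)
open import Relation.Binary.Structures using (IsEquivalence)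
open import Relation.Nullary using (¬_; Dec)
open import Relation.Nullary.Decidable using (dec⇒maybe)

-- Limits are taken with strict ε-N bounds for positive rational ε; being a
-- Σ-type, Cauchy x carries a modulus of convergence.

_∼_ : (x y : ℕ → ℚ) → Set
x ∼ y = ∀ ε → 0ℚ ℚ.< ε →
  ∃ λ N → ∀ m n → N ℕ.≤ m → N ℕ.≤ n → ℚ.∣ x m ℚ.- y n ∣ ℚ.< ε

Cauchy : (ℕ → ℚ) → Set
Cauchy x = x ∼ x

_≋_ : (x y : ℕ → ℚ) → Set
x ≋ y = ∀ ε → 0ℚ ℚ.< ε →
  ∃ λ N → ∀ n → N ℕ.≤ n → ℚ.∣ x n ℚ.- y n ∣ ℚ.< ε

private
  module S = +-*-Solver

  half : ∀ {ε} → 0ℚ ℚ.< ε → 0ℚ ℚ.< ½ ℚ.* ε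
  half {ε} 0<ε = subst (ℚ._< ½ ℚ.* ε) (ℚₚ.*-zeroʳ ½) (ℚₚ.*-monoʳ-<-pos ½ 0<ε)

  half+half : ∀ ε → ½ ℚ.* ε ℚ.+ ½ ℚ.* ε ≡ ε
  half+half ε = trans (sym (ℚₚ.*-distribʳ-+ ε ½ ½)) (ℚₚ.*-identityˡ ε)

  triangle : ∀ {p a b ε} → p ≡ a ℚ.+ b →
             ℚ.∣ a ∣ ℚ.< ½ ℚ.* ε → ℚ.∣ b ∣ ℚ.< ½ ℚ.* ε → ℚ.∣ p ∣ ℚ.< ε
  triangle {a = a} {b} {ε} refl a< b< = subst (_ ℚ.<_) (half+half ε)
    (ℚₚ.≤-<-trans (ℚₚ.∣p+q∣≤∣p∣+∣q∣ a b) (ℚₚ.+-mono-< a< b<))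

  flip : ∀ p q → ℚ.∣ p ℚ.- q ∣ ≡ ℚ.∣ q ℚ.- p ∣
  flip p q = trans
    (cong ℚ.∣_∣ (S.solve 2 (λ p q → p S.:- q S.:= S.:- (q S.:- p)) refl p q))
    (ℚₚ.∣-p∣≡∣p∣ (q ℚ.- p))

  telescope : ∀ p q r → p ℚ.- r ≡ (p ℚ.- q) ℚ.+ (q ℚ.- r)
  telescope = S.solve 3 (λ p q r → p S.:- r S.:= (p S.:- q) S.:+ (q S.:- r)) refl

  ⊔ˡ : ∀ {N M n} → N ℕ.⊔ M ℕ.≤ n → N ℕ.≤ n
  ⊔ˡ {N} {M} = ℕₚ.≤-trans (ℕₚ.m≤m⊔n N M)

  ⊔ʳ : ∀ {N M n} → N ℕ.⊔ M ℕ.≤ n → M ℕ.≤ n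
  ⊔ʳ {N} {M} = ℕₚ.≤-trans (ℕₚ.m≤n⊔m N M)

  ∼⇒≋ : ∀ {x y} → x ∼ y → x ≋ y
  ∼⇒≋ x∼y ε 0<ε with x∼y ε 0<ε
  ... | N , p = N , λ n N≤n → p n n N≤n N≤n

  ≋⇒∼ : ∀ {x y} → Cauchy x → x ≋ y → x ∼ y
  ≋⇒∼ {x} {y} cx x≋y ε 0<ε with cx _ (half 0<ε) | x≋y _ (half 0<ε)
  ... | N , p | M , q = N ℕ.⊔ M , λ m n N≤m N≤n →
    triangle (telescope (x m) (x n) (y n))
      (p m n (⊔ˡ N≤m) (⊔ˡ N≤n)) (q n (⊔ʳ N≤n))

  ≡⇒≋ : ∀ {x y} → (∀ n → x n ≡ y n) → x ≋ y
  ≡⇒≋ {x} {y} x≡y ε 0<ε = 0 , λ n _ →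
    subst (ℚ._< ε) (sym (cong ℚ.∣_∣ (trans (cong (ℚ._- y n) (x≡y n))
                                          (ℚₚ.+-inverseʳ (y n))))) 0<ε

  ≋-sym : ∀ {x y} → x ≋ y → y ≋ x
  ≋-sym {x} {y} x≋y ε 0<ε with x≋y ε 0<ε
  ... | N , p = N , λ n N≤n → subst (ℚ._< ε) (flip (x n) (y n)) (p n N≤n)

  ≋-trans : ∀ {x y z} → x ≋ y → y ≋ z → x ≋ z
  ≋-trans {x} {y} {z} x≋y y≋z ε 0<ε with x≋y _ (half 0<ε) | y≋z _ (half 0<ε)
  ... | N , p | M , q = N ℕ.⊔ M , λ n N≤n →
    triangle (telescope (x n) (y n) (z n)) (p n (⊔ˡ N≤n)) (q n (⊔ʳ N≤n))

  const-∼ : ∀ q → Cauchy (λ _ → q)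
  const-∼ q ε 0<ε = 0 , λ _ _ _ _ →
    subst (ℚ._< ε) (sym (cong ℚ.∣_∣ (ℚₚ.+-inverseʳ q))) 0<ε

  +-∼ : ∀ {x x′ y y′} → x ∼ x′ → y ∼ y′ →
        (λ n → x n ℚ.+ y n) ∼ (λ n → x′ n ℚ.+ y′ n)
  +-∼ {x} {x′} {y} {y′} x∼ y∼ ε 0<ε with x∼ _ (half 0<ε) | y∼ _ (half 0<ε)
  ... | N , p | M , q = N ℕ.⊔ M , λ m n N≤m N≤n →
    triangle
      (S.solve 4 (λ a b c d → (a S.:+ b) S.:- (c S.:+ d)
                         S.:= (a S.:- c) S.:+ (b S.:- d)) refl
               (x m) (y m) (x′ n) (y′ n))
      (p m n (⊔ˡ N≤m) (⊔ˡ N≤n)) (q m n (⊔ʳ N≤m) (⊔ʳ N≤n))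

  neg-∼ : ∀ {x x′} → x ∼ x′ → (λ n → ℚ.- x n) ∼ (λ n → ℚ.- x′ n)
  neg-∼ {x} {x′} x∼ ε 0<ε with x∼ ε 0<ε
  ... | N , p = N , λ m n N≤m N≤n → subst (ℚ._< ε)
    (trans (sym (ℚₚ.∣-p∣≡∣p∣ (x m ℚ.- x′ n)))
      (cong ℚ.∣_∣ (S.solve 2 (λ a b → S.:- (a S.:- b)
                                S.:= (S.:- a) S.:- (S.:- b)) refl (x m) (x′ n))))
    (p m n N≤m N≤n)

  0<1 : 0ℚ ℚ.< 1ℚ
  0<1 = ℚₚ.positive⁻¹ 1ℚ

  bound : ∀ {x} → Cauchy x → ∃ λ B → ∃ λ N → ∀ n → N ℕ.≤ n → ℚ.∣ x n ∣ ℚ.≤ B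
  bound {x} cx with cx 1ℚ 0<1
  ... | N , p = 1ℚ ℚ.+ ℚ.∣ x N ∣ , N , λ n N≤n →
    subst (λ q → ℚ.∣ q ∣ ℚ.≤ 1ℚ ℚ.+ ℚ.∣ x N ∣)
      (S.solve 2 (λ a b → (a S.:- b) S.:+ b S.:= a) refl (x n) (x N))
      (ℚₚ.≤-trans (ℚₚ.∣p+q∣≤∣p∣+∣q∣ (x n ℚ.- x N) (x N))
        (ℚₚ.+-monoˡ-≤ ℚ.∣ x N ∣ (ℚₚ.<⇒≤ (p n N N≤n ℕₚ.≤-refl))))

  *-bound : ∀ {a b B η} → Positive B → 0ℚ ℚ.< η →
            ℚ.∣ a ∣ ℚ.≤ B → ℚ.∣ b ∣ ℚ.< η → ℚ.∣ a ℚ.* b ∣ ℚ.< B ℚ.* η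
  *-bound {a} {b} {B} {η} B>0 η>0 a≤ b< = subst (ℚ._< B ℚ.* η)
    (sym (ℚₚ.∣p*q∣≡∣p∣*∣q∣ a b))
    (ℚₚ.≤-<-trans
      (ℚₚ.*-monoʳ-≤-nonNeg ℚ.∣ b ∣ {{ℚₚ.∣-∣-nonNeg b}} a≤)
      (ℚₚ.*-monoʳ-<-pos B {{B>0}} b<))

  *-∼ : ∀ {x x′ y y′} → Cauchy x → Cauchy y′ → x ∼ x′ → y ∼ y′ →
        (λ n → x n ℚ.* y n) ∼ (λ n → x′ n ℚ.* y′ n)
  *-∼ {x} {x′} {y} {y′} cx cy′ x∼ y∼ ε 0<ε = result
    where
    B C D η : ℚ
    B = proj₁ (bound {x} cx)
    C = proj₁ (bound {y′} cy′)
    D = 1ℚ ℚ.+ (ℚ.∣ B ∣ ℚ.+ ℚ.∣ C ∣)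

    0≤B+C : 0ℚ ℚ.≤ ℚ.∣ B ∣ ℚ.+ ℚ.∣ C ∣
    0≤B+C = ℚₚ.+-mono-≤ (ℚₚ.0≤∣p∣ B) (ℚₚ.0≤∣p∣ C)

    D>0 : Positive D
    D>0 = positive (ℚₚ.+-mono-<-≤ 0<1 0≤B+C)

    B+C≤D : ℚ.∣ B ∣ ℚ.+ ℚ.∣ C ∣ ℚ.≤ D
    B+C≤D = subst (ℚ._≤ D) (ℚₚ.+-identityˡ _)
      (ℚₚ.+-monoˡ-≤ (ℚ.∣ B ∣ ℚ.+ ℚ.∣ C ∣) (ℚₚ.<⇒≤ 0<1))

    ≤abs : ∀ p → p ℚ.≤ ℚ.∣ p ∣
    ≤abs p with ℚₚ.≤-total 0ℚ p
    ... | inj₁ 0≤p = ℚₚ.≤-reflexive (sym (ℚₚ.0≤p⇒∣p∣≡p 0≤p))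
    ... | inj₂ p≤0 = ℚₚ.≤-trans p≤0 (ℚₚ.0≤∣p∣ p)

    B≤D : B ℚ.≤ D
    B≤D = ℚₚ.≤-trans (≤abs B) (ℚₚ.≤-trans
      (subst (ℚ._≤ ℚ.∣ B ∣ ℚ.+ ℚ.∣ C ∣) (ℚₚ.+-identityʳ _)
        (ℚₚ.+-monoʳ-≤ ℚ.∣ B ∣ (ℚₚ.0≤∣p∣ C))) B+C≤D)

    C≤D : C ℚ.≤ D
    C≤D = ℚₚ.≤-trans (≤abs C) (ℚₚ.≤-trans
      (subst (ℚ._≤ ℚ.∣ B ∣ ℚ.+ ℚ.∣ C ∣) (ℚₚ.+-identityˡ _)
        (ℚₚ.+-monoˡ-≤ ℚ.∣ C ∣ (ℚₚ.0≤∣p∣ B))) B+C≤D)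

    D≢0 : ℚ.NonZero D
    D≢0 = ℚₚ.pos⇒nonZero D {{D>0}}

    D⁻¹ : ℚ
    D⁻¹ = (ℚ.1/ D) {{D≢0}}

    η = D⁻¹ ℚ.* (½ ℚ.* ε)

    η>0 : 0ℚ ℚ.< η
    η>0 = subst (ℚ._< η) (ℚₚ.*-zeroʳ D⁻¹)
      (ℚₚ.*-monoʳ-<-pos D⁻¹ {{ℚₚ.1/pos⇒pos D {{D>0}}}} (half 0<ε))

    Dη : D ℚ.* η ≡ ½ ℚ.* ε
    Dη = trans (sym (ℚₚ.*-assoc D D⁻¹ _))
      (trans (cong (ℚ._* (½ ℚ.* ε)) (ℚₚ.*-inverseʳ D {{D≢0}}))
             (ℚₚ.*-identityˡ _))

    K L N M : ℕ
    K = proj₁ (proj₂ (bound {x} cx))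
    L = proj₁ (proj₂ (bound {y′} cy′))
    N = proj₁ (x∼ η η>0)
    M = proj₁ (y∼ η η>0)

    result : ∃ λ T → ∀ m n → T ℕ.≤ m → T ℕ.≤ n →
             ℚ.∣ x m ℚ.* y m ℚ.- x′ n ℚ.* y′ n ∣ ℚ.< ε
    result = (K ℕ.⊔ L) ℕ.⊔ (N ℕ.⊔ M) , λ m n T≤m T≤n →
      triangle
        (S.solve 4 (λ a b c d → a S.:* b S.:- c S.:* d
                     S.:= a S.:* (b S.:- d) S.:+ d S.:* (a S.:- c)) refl
                   (x m) (y m) (x′ n) (y′ n))
        (subst (ℚ.∣ x m ℚ.* (y m ℚ.- y′ n) ∣ ℚ.<_) Dη
          (*-bound D>0 η>0
            (ℚₚ.≤-trans (proj₂ (proj₂ (bound {x} cx)) m (⊔ˡ {K} (⊔ˡ {K ℕ.⊔ L} T≤m))) B≤D)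
            (proj₂ (y∼ η η>0) m n (⊔ʳ {N} (⊔ʳ {K ℕ.⊔ L} T≤m)) (⊔ʳ {N} (⊔ʳ {K ℕ.⊔ L} T≤n)))))
        (subst (ℚ.∣ y′ n ℚ.* (x m ℚ.- x′ n) ∣ ℚ.<_) Dη
          (*-bound D>0 η>0
            (ℚₚ.≤-trans (proj₂ (proj₂ (bound {y′} cy′)) n (⊔ʳ {K} (⊔ˡ {K ℕ.⊔ L} T≤n))) C≤D)
            (proj₂ (x∼ η η>0) m n (⊔ˡ {N} (⊔ʳ {K ℕ.⊔ L} T≤m)) (⊔ˡ {N} (⊔ʳ {K ℕ.⊔ L} T≤n)))))

-- Real numbers are Cauchy sequences of rationals, with the setoid equality
-- _≈ℝ_ in place of a quotient.  Without η, an arithmetic operation applied to arguments is a normal form,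
-- so that the arguments can be inferred from the result.
record ℝ : Set where
  no-eta-equality
  constructor mkℝ
  field
    seq    : ℕ → ℚ
    cauchy : Cauchy seq

open ℝ public

infix 4 _≈ℝ_

record _≈ℝ_ (x y : ℝ) : Set where
  constructor mk≈
  field
    vanish : seq x ≋ seq y

open _≈ℝ_ public

infixl 6 _+ℝ_ _-ℝ_
infixl 7 _*ℝ_
infix  8 -ℝ_

_+ℝ_ : ℝ → ℝ → ℝ
seq    (x +ℝ y) n = seq x n ℚ.+ seq y n
cauchy (x +ℝ y)   = +-∼ {seq x} {seq x} {seq y} {seq y} (cauchy x) (cauchy y)

_*ℝ_ : ℝ → ℝ → ℝ
seq    (x *ℝ y) n = seq x n ℚ.* seq y n
cauchy (x *ℝ y)   = *-∼ {seq x} {seq x} {seq y} {seq y}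
                        (cauchy x) (cauchy y) (cauchy x) (cauchy y)

-ℝ_ : ℝ → ℝ
seq    (-ℝ x) n = ℚ.- seq x n
cauchy (-ℝ x)   = neg-∼ {seq x} {seq x} (cauchy x)

_-ℝ_ : ℝ → ℝ → ℝ
x -ℝ y = x +ℝ (-ℝ y)

ℚ⇒ℝ : ℚ → ℝ
seq    (ℚ⇒ℝ q) _ = q
cauchy (ℚ⇒ℝ q)   = const-∼ q

pointwise : ∀ {x y} → (∀ n → seq x n ≡ seq y n) → x ≈ℝ y
pointwise {x} {y} x≡y = mk≈ (≡⇒≋ {seq x} {seq y} x≡y)

≈ℝ-refl : ∀ {x} → x ≈ℝ x
≈ℝ-refl = pointwise λ _ → refl

≈ℝ-sym : ∀ {x y} → x ≈ℝ y → y ≈ℝ x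
≈ℝ-sym {x} {y} (mk≈ p) = mk≈ (≋-sym {seq x} {seq y} p)

≈ℝ-trans : ∀ {x y z} → x ≈ℝ y → y ≈ℝ z → x ≈ℝ z
≈ℝ-trans {x} {y} {z} (mk≈ p) (mk≈ q) =
  mk≈ (≋-trans {seq x} {seq y} {seq z} p q)

private
  joint : ∀ {x y} → x ≈ℝ y → seq x ∼ seq y
  joint {x} {y} (mk≈ p) = ≋⇒∼ {seq x} {seq y} (cauchy x) p

  fromJoint : ∀ {x y} → seq x ∼ seq y → x ≈ℝ y
  fromJoint {x} {y} p = mk≈ (∼⇒≋ {seq x} {seq y} p)

+ℝ-cong : ∀ {x x′ y y′} → x ≈ℝ x′ → y ≈ℝ y′ → x +ℝ y ≈ℝ x′ +ℝ y′
+ℝ-cong {x} {x′} {y} {y′} p q = fromJoint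
  (+-∼ {seq x} {seq x′} {seq y} {seq y′} (joint p) (joint q))

*ℝ-cong : ∀ {x x′ y y′} → x ≈ℝ x′ → y ≈ℝ y′ → x *ℝ y ≈ℝ x′ *ℝ y′
*ℝ-cong {x} {x′} {y} {y′} p q = fromJoint
  (*-∼ {seq x} {seq x′} {seq y} {seq y′} (cauchy x) (cauchy y′) (joint p) (joint q))

-ℝ-cong : ∀ {x x′} → x ≈ℝ x′ → -ℝ x ≈ℝ -ℝ x′
-ℝ-cong {x} {x′} p = fromJoint (neg-∼ {seq x} {seq x′} (joint p))

record ℂ : Set where
  no-eta-equality
  constructor _+i_
  field
    re im : ℝ

open ℂ public

infix 4 _≈ℂ_

record _≈ℂ_ (z w : ℂ) : Set where
  constructor mk≈
  field
    re≈ : re z ≈ℝ re w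
    im≈ : im z ≈ℝ im w

open _≈ℂ_ public

infixl 6 _+ℂ_
infixl 7 _*ℂ_
infix  8 -ℂ_

_+ℂ_ : ℂ → ℂ → ℂ
re (z +ℂ w) = re z +ℝ re w
im (z +ℂ w) = im z +ℝ im w

_*ℂ_ : ℂ → ℂ → ℂ
re (z *ℂ w) = re z *ℝ re w -ℝ im z *ℝ im w
im (z *ℂ w) = re z *ℝ im w +ℝ im z *ℝ re w

-ℂ_ : ℂ → ℂ
re (-ℂ z) = -ℝ re z
im (-ℂ z) = -ℝ im z

ℚ⇒ℂ : ℚ → ℂ
re (ℚ⇒ℂ q) = ℚ⇒ℝ q
im (ℚ⇒ℂ q) = ℚ⇒ℝ 0ℚ

private
  open S using (solve; _:+_; _:*_; _:-_; _:=_; con)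

  ≈-isEquivalence : IsEquivalence _≈ℂ_
  ≈-isEquivalence = record
    { refl  = mk≈ ≈ℝ-refl ≈ℝ-refl
    ; sym   = λ (mk≈ p q) → mk≈ (≈ℝ-sym p) (≈ℝ-sym q)
    ; trans = λ (mk≈ p q) (mk≈ p′ q′) → mk≈ (≈ℝ-trans p p′) (≈ℝ-trans q q′)
    }

  *ℂ-assoc : ∀ x y z → (x *ℂ y) *ℂ z ≈ℂ x *ℂ (y *ℂ z)
  *ℂ-assoc x y z = mk≈
    (pointwise λ n → solve 6 (λ a b c d e f →
         (a :* c :- b :* d) :* e :- (a :* d :+ b :* c) :* f
      := a :* (c :* e :- d :* f) :- b :* (c :* f :+ d :* e)) refl
      (seq (re x) n) (seq (im x) n) (seq (re y) n) (seq (im y) n) (seq (re z) n) (seq (im z) n))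
    (pointwise λ n → solve 6 (λ a b c d e f →
         (a :* c :- b :* d) :* f :+ (a :* d :+ b :* c) :* e
      := a :* (c :* f :+ d :* e) :+ b :* (c :* e :- d :* f)) refl
      (seq (re x) n) (seq (im x) n) (seq (re y) n) (seq (im y) n) (seq (re z) n) (seq (im z) n))

  *ℂ-comm : ∀ x y → x *ℂ y ≈ℂ y *ℂ x
  *ℂ-comm x y = mk≈
    (pointwise λ n → solve 4 (λ a b c d →
      a :* c :- b :* d := c :* a :- d :* b) refl
      (seq (re x) n) (seq (im x) n) (seq (re y) n) (seq (im y) n))
    (pointwise λ n → solve 4 (λ a b c d →
      a :* d :+ b :* c := c :* b :+ d :* a) refl
      (seq (re x) n) (seq (im x) n) (seq (re y) n) (seq (im y) n))

  *ℂ-identityˡ : ∀ x → ℚ⇒ℂ 1ℚ *ℂ x ≈ℂ x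
  *ℂ-identityˡ x = mk≈
    (pointwise λ n → solve 2 (λ a b →
      con 1ℚ :* a :- con 0ℚ :* b := a) refl (seq (re x) n) (seq (im x) n))
    (pointwise λ n → solve 2 (λ a b →
      con 1ℚ :* b :+ con 0ℚ :* a := b) refl (seq (re x) n) (seq (im x) n))

  *ℂ-identityʳ : ∀ x → x *ℂ ℚ⇒ℂ 1ℚ ≈ℂ x
  *ℂ-identityʳ x = IsEquivalence.trans ≈-isEquivalence
    (*ℂ-comm x (ℚ⇒ℂ 1ℚ)) (*ℂ-identityˡ x)

  *ℂ-distribˡ : ∀ x y z → x *ℂ (y +ℂ z) ≈ℂ x *ℂ y +ℂ x *ℂ z
  *ℂ-distribˡ x y z = mk≈
    (pointwise λ n → solve 6 (λ a b c d e f →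
         a :* (c :+ e) :- b :* (d :+ f)
      := (a :* c :- b :* d) :+ (a :* e :- b :* f)) refl
      (seq (re x) n) (seq (im x) n) (seq (re y) n) (seq (im y) n) (seq (re z) n) (seq (im z) n))
    (pointwise λ n → solve 6 (λ a b c d e f →
         a :* (d :+ f) :+ b :* (c :+ e)
      := (a :* d :+ b :* c) :+ (a :* f :+ b :* e)) refl
      (seq (re x) n) (seq (im x) n) (seq (re y) n) (seq (im y) n) (seq (re z) n) (seq (im z) n))

  *ℂ-distribʳ : ∀ x y z → (y +ℂ z) *ℂ x ≈ℂ y *ℂ x +ℂ z *ℂ x
  *ℂ-distribʳ x y z = mk≈
    (pointwise λ n → solve 6 (λ a b c d e f →
         (c :+ e) :* a :- (d :+ f) :* b
      := (c :* a :- d :* b) :+ (e :* a :- f :* b)) refl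
      (seq (re x) n) (seq (im x) n) (seq (re y) n) (seq (im y) n) (seq (re z) n) (seq (im z) n))
    (pointwise λ n → solve 6 (λ a b c d e f →
         (c :+ e) :* b :+ (d :+ f) :* a
      := (c :* b :+ d :* a) :+ (e :* b :+ f :* a)) refl
      (seq (re x) n) (seq (im x) n) (seq (re y) n) (seq (im y) n) (seq (re z) n) (seq (im z) n))

  +ℂ-cong : ∀ {x x′ y y′} → x ≈ℂ x′ → y ≈ℂ y′ → x +ℂ y ≈ℂ x′ +ℂ y′
  +ℂ-cong (mk≈ p q) (mk≈ p′ q′) = mk≈ (+ℝ-cong p p′) (+ℝ-cong q q′)

  -ℂ-cong : ∀ {x x′} → x ≈ℂ x′ → -ℂ x ≈ℂ -ℂ x′
  -ℂ-cong (mk≈ p q) = mk≈ (-ℝ-cong p) (-ℝ-cong q)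

  *ℂ-cong : ∀ {x x′ y y′} → x ≈ℂ x′ → y ≈ℂ y′ → x *ℂ y ≈ℂ x′ *ℂ y′
  *ℂ-cong (mk≈ p q) (mk≈ p′ q′) = mk≈
    (+ℝ-cong (*ℝ-cong p p′) (-ℝ-cong (*ℝ-cong q q′)))
    (+ℝ-cong (*ℝ-cong p q′) (*ℝ-cong q p′))

  +ℂ-assoc : ∀ x y z → (x +ℂ y) +ℂ z ≈ℂ x +ℂ (y +ℂ z)
  +ℂ-assoc x y z = mk≈
    (pointwise λ n → ℚₚ.+-assoc (seq (re x) n) (seq (re y) n) (seq (re z) n))
    (pointwise λ n → ℚₚ.+-assoc (seq (im x) n) (seq (im y) n) (seq (im z) n))

  +ℂ-comm : ∀ x y → x +ℂ y ≈ℂ y +ℂ x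
  +ℂ-comm x y = mk≈
    (pointwise λ n → ℚₚ.+-comm (seq (re x) n) (seq (re y) n))
    (pointwise λ n → ℚₚ.+-comm (seq (im x) n) (seq (im y) n))

  +ℂ-identityˡ : ∀ x → ℚ⇒ℂ 0ℚ +ℂ x ≈ℂ x
  +ℂ-identityˡ x = mk≈ (pointwise λ n → ℚₚ.+-identityˡ (seq (re x) n))
                              (pointwise λ n → ℚₚ.+-identityˡ (seq (im x) n))

  +ℂ-identityʳ : ∀ x → x +ℂ ℚ⇒ℂ 0ℚ ≈ℂ x
  +ℂ-identityʳ x = mk≈ (pointwise λ n → ℚₚ.+-identityʳ (seq (re x) n))
                              (pointwise λ n → ℚₚ.+-identityʳ (seq (im x) n))

  -ℂ-inverseˡ : ∀ x → (-ℂ x) +ℂ x ≈ℂ ℚ⇒ℂ 0ℚ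
  -ℂ-inverseˡ x = mk≈ (pointwise λ n → ℚₚ.+-inverseˡ (seq (re x) n))
                             (pointwise λ n → ℚₚ.+-inverseˡ (seq (im x) n))

  -ℂ-inverseʳ : ∀ x → x +ℂ (-ℂ x) ≈ℂ ℚ⇒ℂ 0ℚ
  -ℂ-inverseʳ x = mk≈ (pointwise λ n → ℚₚ.+-inverseʳ (seq (re x) n))
                             (pointwise λ n → ℚₚ.+-inverseʳ (seq (im x) n))

ℂ-commutativeRing : CommutativeRing 0ℓ 0ℓ
ℂ-commutativeRing = record
  { Carrier = ℂ ; _≈_ = _≈ℂ_ ; _+_ = _+ℂ_ ; _*_ = _*ℂ_ ; -_ = -ℂ_
  ; 0# = ℚ⇒ℂ 0ℚ ; 1# = ℚ⇒ℂ 1ℚ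
  ; isCommutativeRing = record
    { isRing = record
      { +-isAbelianGroup = record
        { isGroup = record
          { isMonoid = record
            { isSemigroup = record
              { isMagma = record
                { isEquivalence = ≈-isEquivalence
                ; ∙-cong        = +ℂ-cong
                }
              ; assoc = +ℂ-assoc
              }
            ; identity = +ℂ-identityˡ , +ℂ-identityʳ
            }
          ; inverse = -ℂ-inverseˡ , -ℂ-inverseʳ
          ; ⁻¹-cong = -ℂ-cong
          }
        ; comm = +ℂ-comm
        }
      ; *-cong     = *ℂ-cong
      ; *-assoc    = *ℂ-assoc
      ; *-identity = *ℂ-identityˡ , *ℂ-identityʳ
      ; distrib    = *ℂ-distribˡ , *ℂ-distribʳ
      }
    ; *-comm = *ℂ-comm
    }
  }

open CommutativeRing ℂ-commutativeRing public
  using (0#; 1#; _≈_; _+_; _*_)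

∏ : ∀ {r} → (Fin r → ℂ) → ℂ
∏ = Sum.sum (CommutativeRing.*-commutativeMonoid ℂ-commutativeRing)

∑ : ∀ {A : Set} → List A → (A → ℂ) → ℂ
∑ xs F = List.foldr (λ x s → F x + s) 0# xs

-- The proof of positivity is irrelevant, so elements with equal values
-- are propositionally equal.
record ℕ⁺ : Set where
  constructor pos
  field
    value        : ℕ
    .{{nonZero}} : NonZero value

open ℕ⁺ public using (value)

infixl 7 _*⁺_
infix  4 _∣⁺_ _∣⁺?_

1⁺ : ℕ⁺
1⁺ = pos 1

_*⁺_ gcd⁺ lcm⁺ : ℕ⁺ → ℕ⁺ → ℕ⁺
pos m *⁺ pos n = pos (m ℕ.* n) {{ℕₚ.m*n≢0 m n}}

gcd⁺ (pos m) (pos n) = pos (GCD.gcd m n)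
  {{ℕ.≢-nonZero (GCD.gcd[m,n]≢0 m n (inj₁ (ℕ.≢-nonZero⁻¹ m)))}}

lcm⁺ (pos m) (pos n) = pos (LCM.lcm m n)
  {{ℕₚ.m*n≢0⇒n≢0 (GCD.gcd m n) {{subst NonZero (sym (LCM.gcd*lcm m n)) (ℕₚ.m*n≢0 m n)}}}}

_∣⁺_ : ℕ⁺ → ℕ⁺ → Set
d ∣⁺ n = value d ∣.∣ value n

_∣⁺?_ : ∀ d n → Dec (d ∣⁺ n)
d ∣⁺? n = value d ∣.∣? value n

infix 8 _/_⟨_⟩

_/_⟨_⟩ : ∀ n d → .(d ∣⁺ n) → ℕ⁺
pos n / pos d ⟨ d∣n ⟩ = pos (n DivMod./ d)
  {{ℕ.>-nonZero (DivMod.m≥n⇒m/n>0 (∣.∣⇒≤ d∣n))}}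

∏⁺ Lcm : ∀ {r} → (Fin r → ℕ⁺) → ℕ⁺
∏⁺  = Vector.foldr _*⁺_ 1⁺
Lcm = Vector.foldr lcm⁺ 1⁺

1… : ℕ⁺ → List ℕ⁺
1… n = List.map (λ k → pos (ℕ.suc k)) (upTo (value n))

-- Euler's totient: the number of k ∈ {1, …, n} coprime to n.
φ : ℕ⁺ → ℕ
φ n = length (filter (λ k → coprime? (value k) (value n)) (1… n))

Divisor : ℕ⁺ → Set
Divisor n = ∃ λ d → d ∣⁺ n

divisors : ∀ n → List (Divisor n)
divisors n = mapMaybe (λ d → Maybe.map (d ,_) (dec⇒maybe (d ∣⁺? n))) (1… n)

divisorTuples : ∀ {r} (m : Fin r → ℕ⁺) → List (∀ i → Divisor (m i))
divisorTuples {ℕ.zero}  m = (λ ()) ∷ []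
divisorTuples {ℕ.suc r} m =
  cartesianProductWith ∀-cons (divisors (m zero)) (divisorTuples (m ∘ suc))

ℕ⇒ℂ : ℕ → ℂ
ℕ⇒ℂ n = ℚ⇒ℂ (ℤ.+ n ℚ./ 1)

1/_ : ℕ⁺ → ℂ
1/ pos n = ℚ⇒ℂ (ℤ.+ 1 ℚ./ n)

-- "Not identically zero" is read as the negation of "zero everywhere"; no
-- apartness from 0 at a specific argument is asked for.
record IsMultiplicative {r} (F : (Fin r → ℕ⁺) → ℂ) : Set where
  field
    notAllZero : ¬ (∀ m → F m ≈ 0#)
    homo       : ∀ m n → gcd⁺ (∏⁺ m) (∏⁺ n) ≡ 1⁺ →
                 F (λ i → m i *⁺ n i) ≈ F m * F n

IsMultiplicative₁ : (ℕ⁺ → ℂ) → Set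
IsMultiplicative₁ g = IsMultiplicative {1} λ m → g (m zero)

ramanujan : (g h : ℕ⁺ → ℂ) → ℕ⁺ → ℕ⁺ → ℂ
ramanujan g h k n = ∑ (divisors (gcd⁺ k n)) λ (d , d∣gcd) →
  g d * h (n / d ⟨ ∣.∣-trans d∣gcd (GCD.gcd[m,n]∣n (value k) (value n)) ⟩)

average : (f : ℕ⁺ → ℕ⁺ → ℂ) → ∀ {r} → (Fin r → ℕ⁺) → ℂ
average f m = 1/ Lcm m * ∑ (1… (Lcm m)) λ k → ∏ λ i → f k (m i)

{-# OPTIONS --safe #-}
-- Writing f(k,n) as the sum over d ∣ n of [d ∣ k] g(d) h(n/d), the product
-- f(k,m₁)⋯f(k,mᵣ) becomes a linear combination, over tuples of divisors dᵢ ∣ mᵢ,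
-- of the indicators [lcm(d₁,…,dᵣ) ∣ k], and the mean of [l ∣ k] over k = 1,…,n
-- is 1/l for every multiple n of l.  The totient formula groups the k by
-- gcd(k,m), on which f(k,m₁),…,f(k,mᵣ) depend.  For (ii), f(k,·) is
-- multiplicative, and for coprime l, l′ the mean of [l ∣ k][l′ ∣ k] = [ll′ ∣ k]
-- is 1/(ll′), so the average of a product of two such combinations with
-- coprime moduli is the product of their averages.
module Submission where

open import Defs
open import Data.Fin.Base using (Fin)
open import Data.Nat.Base using (ℕ; NonZero)
open import Data.Product.Base using (_×_; _,_; proj₁; proj₂)

open import Algebra.Bundles using (CommutativeRing)
import Algebra.Properties.CommutativeMonoid.Sum as Sum
import Algebra.Properties.CommutativeSemigroup as CommutativeSemigroup
open import Data.Bool.Base using (if_then_else_; true; false)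
open import Data.Empty using (⊥-elim)
open import Data.Fin.Base using (zero; suc)
import Data.Integer.Base as ℤ
import Data.Integer.Properties as ℤₚ
open import Data.List.Base as List
  using (List; []; _∷_; map; filter; length; upTo; cartesianProduct; cartesianProductWith; mapMaybe)
open import Data.List.Membership.Propositional using (_∈_)
open import Data.List.Membership.Propositional.Properties
  using (∈-map⁺; ∈-map⁻; ∈-filter⁺; ∈-filter⁻; ∈-upTo⁺; ∈-upTo⁻; ∈-cartesianProduct⁺; ∈-cartesianProduct⁻)
open import Data.List.Membership.Propositional.Properties.WithK using (unique∧set⇒bag)
open import Data.List.Properties using (length-upTo; length-map)
open import Data.List.Relation.Binary.BagAndSetEquality using (∼bag⇒↭)
open import Data.List.Relation.Binary.Permutation.Propositional as ↭ using (_↭_)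
open import Data.List.Relation.Unary.All as All using ([])
import Data.List.Relation.Unary.All.Properties as All
open import Data.List.Relation.Unary.AllPairs using ([]; _∷_)
open import Data.List.Relation.Unary.Any using (here; there)
open import Data.List.Relation.Unary.Unique.Propositional using (Unique)
open import Data.List.Relation.Unary.Unique.Propositional.Properties
  using (upTo⁺; filter⁺; map⁺; cartesianProduct⁺)
import Data.Maybe.Base as Maybe
import Data.Nat.Base as ℕ
open import Data.Nat.Coprimality as Coprime
  using (Coprime; coprime?; coprime-divisor; gcd≡1⇒coprime; coprime⇒gcd≡1)
import Data.Nat.Divisibility as ∣
import Data.Nat.DivMod as DivMod
import Data.Nat.GCD as GCD
import Data.Nat.LCM as LCM
import Data.Nat.Properties as ℕₚ
open import Data.Product.Base using (∃; uncurry)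
open import Data.Rational.Base as ℚ using (ℚ; 0ℚ; 1ℚ; ½; positive; nonNegative; nonPositive)
import Data.Rational.Properties as ℚₚ
open import Data.Rational.Solver using (module +-*-Solver)
import Data.Rational.Unnormalised.Base as ℚᵘ
import Data.Rational.Unnormalised.Properties as ℚᵘₚ
open import Data.Sum.Base using (inj₁; inj₂)
open import Function.Base using (_∘_; const)
open import Function.Bundles using (_⇔_; mk⇔; Equivalence)
import Relation.Binary.PropositionalEquality as ≡
open ≡ using (_≡_; refl; cong; cong₂; subst)
open import Relation.Nullary using (¬_)
open import Relation.Nullary.Decidable
  using (Dec; yes; no; does; does-⇔; _×-dec_; dec-true; dec⇒maybe; map′)
open import Relation.Unary using (Pred; Decidable)

open CommutativeRing ℂ-commutativeRing
  using ( setoid; sym; trans; reflexive; +-cong; +-congˡ; +-congʳ; *-cong; *-congˡ; *-congʳ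
        ; +-assoc; +-identityˡ; +-identityʳ; *-assoc; *-comm; *-identityˡ; *-identityʳ
        ; distribˡ; distribʳ; zeroˡ; zeroʳ
        ; +-commutativeSemigroup; *-commutativeSemigroup; *-commutativeMonoid)
  renaming (refl to ≈-refl)
open import Relation.Binary.Reasoning.Setoid setoid
open +-*-Solver using (solve; _:=_; _:+_; _:*_; _:-_; con)

module + = CommutativeSemigroup +-commutativeSemigroup
module * = CommutativeSemigroup *-commutativeSemigroup
module Π = Sum *-commutativeMonoid

private variable
  A B : Set
  P Q : Set
  r : ℕ

-- Finite sums and products

∑-cong-∈ : ∀ (xs : List A) {F G} → (∀ {x} → x ∈ xs → F x ≈ G x) → ∑ xs F ≈ ∑ xs G
∑-cong-∈ []       F≈G = ≈-refl
∑-cong-∈ (x ∷ xs) F≈G = +-cong (F≈G (here refl)) (∑-cong-∈ xs (F≈G ∘ there))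

∑-cong : ∀ (xs : List A) {F G} → (∀ x → F x ≈ G x) → ∑ xs F ≈ ∑ xs G
∑-cong xs F≈G = ∑-cong-∈ xs λ {x} _ → F≈G x

∑-map : ∀ (f : A → B) xs {G} → ∑ (map f xs) G ≡ ∑ xs (G ∘ f)
∑-map f []       = refl
∑-map f (x ∷ xs) = cong (_ +_) (∑-map f xs)

∑-↭ : ∀ {xs ys : List A} {F} → xs ↭ ys → ∑ xs F ≈ ∑ ys F
∑-↭ ↭.refl         = ≈-refl
∑-↭ (↭.prep x p)   = +-congˡ (∑-↭ p)
∑-↭ (↭.swap x y p) = trans (+-congˡ (+-congˡ (∑-↭ p))) (+.x∙yz≈y∙xz _ _ _)
∑-↭ (↭.trans p q)  = trans (∑-↭ p) (∑-↭ q)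

∑-zero : ∀ (xs : List A) → ∑ xs (const 0#) ≈ 0#
∑-zero []       = ≈-refl
∑-zero (x ∷ xs) = trans (+-identityˡ _) (∑-zero xs)

∑-+ : ∀ (xs : List A) {F G} → ∑ xs (λ x → F x + G x) ≈ ∑ xs F + ∑ xs G
∑-+ []       = sym (+-identityˡ 0#)
∑-+ (x ∷ xs) = trans (+-congˡ (∑-+ xs)) (+.interchange _ _ _ _)

*-∑ : ∀ (xs : List A) {c F} → c * ∑ xs F ≈ ∑ xs (λ x → c * F x)
*-∑ []       = zeroʳ _
*-∑ (x ∷ xs) = trans (distribˡ _ _ _) (+-congˡ (*-∑ xs))

∑-* : ∀ (xs : List A) {c F} → ∑ xs F * c ≈ ∑ xs (λ x → F x * c)
∑-* []       = zeroˡ _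
∑-* (x ∷ xs) = trans (distribʳ _ _ _) (+-congˡ (∑-* xs))

∑-swap : ∀ (xs : List A) (ys : List B) {F : A → B → ℂ} →
         ∑ xs (λ x → ∑ ys (F x)) ≈ ∑ ys (λ y → ∑ xs (λ x → F x y))
∑-swap []       ys = sym (∑-zero ys)
∑-swap (x ∷ xs) ys = trans (+-congˡ (∑-swap xs ys)) (sym (∑-+ ys))

∑-++ : ∀ (xs ys : List A) {F} → ∑ (xs List.++ ys) F ≈ ∑ xs F + ∑ ys F
∑-++ []       ys = sym (+-identityˡ _)
∑-++ (x ∷ xs) ys = trans (+-congˡ (∑-++ xs ys)) (sym (+-assoc _ _ _))

∑-cartesianProductWith : ∀ {C : Set} (f : A → B → C) xs ys {F} →
  ∑ (cartesianProductWith f xs ys) F ≈ ∑ xs (λ x → ∑ ys (λ y → F (f x y)))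
∑-cartesianProductWith f []       ys = ≈-refl
∑-cartesianProductWith f (x ∷ xs) ys = trans (∑-++ (map (f x) ys) _)
  (+-cong (reflexive (∑-map (f x) ys)) (∑-cartesianProductWith f xs ys))

∑*∑ : ∀ (xs : List A) (ys : List B) {F G} →
      ∑ xs F * ∑ ys G ≈ ∑ (cartesianProduct xs ys) (λ (x , y) → F x * G y)
∑*∑ xs ys = trans (∑-* xs)
  (trans (∑-cong xs λ _ → *-∑ ys) (sym (∑-cartesianProductWith _,_ xs ys)))

-- Injectivity is asked only on members of the list: in `∑-divs-*` the map `(a , b) ↦ ab` is
-- injective only on divisors of coprime numbers.
unique-map : ∀ {f : A → B} {xs} → Unique xs →
             (∀ {x y} → x ∈ xs → y ∈ xs → f x ≡ f y → x ≡ y) → Unique (map f xs)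
unique-map []         inj = []
unique-map (x∉ ∷ xs!) inj =
  All.map⁺ (All.tabulate λ y∈ fx≡fy → All.lookup x∉ y∈ (inj (here refl) (there y∈) fx≡fy))
  ∷ unique-map xs! (λ x∈ y∈ → inj (there x∈) (there y∈))

-- Duplicate-free lists with the same members are permutations of each other, so a bijection on
-- members is enough and the order of enumeration is never tracked.
∑-reindex : ∀ {xs : List A} {ys : List B} (f : A → B) → Unique xs → Unique ys →
            (∀ {x} → x ∈ xs → f x ∈ ys) →
            (∀ {x y} → x ∈ xs → y ∈ xs → f x ≡ f y → x ≡ y) →
            (∀ {y} → y ∈ ys → ∃ λ x → x ∈ xs × y ≡ f x) →
            ∀ {F} → ∑ ys F ≈ ∑ xs (F ∘ f)
∑-reindex {xs = xs} {ys} f xs! ys! f∈ inj surj = trans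
  (∑-↭ (∼bag⇒↭ (unique∧set⇒bag ys! (unique-map xs! inj) (mk⇔ to from))))
  (reflexive (∑-map f xs))
  where
  to : ∀ {y} → y ∈ ys → y ∈ map f xs
  to y∈ with x , x∈ , refl ← surj y∈ = ∈-map⁺ f x∈

  from : ∀ {y} → y ∈ map f xs → y ∈ ys
  from y∈ with x , x∈ , refl ← ∈-map⁻ f y∈ = f∈ x∈

∑-sameElements : ∀ {xs ys : List A} → Unique xs → Unique ys →
                 (∀ {x} → x ∈ xs ⇔ x ∈ ys) → ∀ {F} → ∑ xs F ≈ ∑ ys F
∑-sameElements xs! ys! xs∼ys = ∑-↭ (∼bag⇒↭ (unique∧set⇒bag xs! ys! xs∼ys))

𝟙 : Dec P → ℂ
𝟙 p = if does p then 1# else 0#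

𝟙-cong : P ⇔ Q → (p : Dec P) (q : Dec Q) → 𝟙 p ≡ 𝟙 q
𝟙-cong P⇔Q p q = cong (if_then 1# else 0#) (does-⇔ P⇔Q p q)

𝟙-× : (p : Dec P) (q : Dec Q) → 𝟙 (p ×-dec q) ≈ 𝟙 p * 𝟙 q
𝟙-× p q with does p
... | true  = sym (*-identityˡ _)
... | false = sym (zeroˡ _)

∑-filter : ∀ {P : Pred A _} (P? : Decidable P) xs {F} →
           ∑ (filter P? xs) F ≈ ∑ xs (λ x → 𝟙 (P? x) * F x)
∑-filter P? []       = ≈-refl
∑-filter P? (x ∷ xs) with does (P? x)
... | true  = +-cong (sym (*-identityˡ _)) (∑-filter P? xs)
... | false = trans (∑-filter P? xs) (sym (trans (+-congʳ (zeroˡ _)) (+-identityˡ _)))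

-- The list on the left has the shape of `divisors`, whose entries carry proofs. A summand that
-- ignores them can be summed over numbers alone, where uniqueness and membership are easy to
-- handle.
∑-mapMaybe : ∀ {P : Pred A _} (P? : Decidable P) xs {F : A → ℂ} →
  ∑ (mapMaybe (λ x → Maybe.map (x ,_) (dec⇒maybe (P? x))) xs) (F ∘ proj₁) ≡ ∑ (filter P? xs) F
∑-mapMaybe P? []       = refl
∑-mapMaybe P? (x ∷ xs) with P? x
... | yes _ = cong (_ +_) (∑-mapMaybe P? xs)
... | no  _ = ∑-mapMaybe P? xs

∏-cong : {F G : Fin r → ℂ} → (∀ i → F i ≈ G i) → ∏ F ≈ ∏ G
∏-cong = Π.sum-cong-≋

∏-* : (F G : Fin r → ℂ) → ∏ (λ i → F i * G i) ≈ ∏ F * ∏ G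
∏-* = Π.∑-distrib-+

-- Distributivity, by an induction that follows the recursion of `divisorTuples`; the empty family
-- has exactly one tuple, matching the empty product.
∏-∑-divisors : (m : Fin r → ℕ⁺) {F : ∀ i → Divisor (m i) → ℂ} →
  ∏ (λ i → ∑ (divisors (m i)) (F i)) ≈ ∑ (divisorTuples m) (λ d → ∏ (λ i → F i (d i)))
∏-∑-divisors {ℕ.zero}  m = sym (+-identityʳ _)
∏-∑-divisors {ℕ.suc r} m {F} = begin
  ∑ (divisors (m zero)) (F zero) * ∏ (λ i → ∑ (divisors (m (suc i))) (F (suc i)))
    ≈⟨ *-congˡ (∏-∑-divisors (m ∘ suc)) ⟩
  ∑ (divisors (m zero)) (F zero) * ∑ (divisorTuples (m ∘ suc)) (λ d → ∏ (λ i → F (suc i) (d i)))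
    ≈⟨ trans (∑-* (divisors (m zero))) (∑-cong (divisors (m zero)) λ _ → *-∑ (divisorTuples (m ∘ suc))) ⟩
  ∑ (divisors (m zero)) (λ d₀ → ∑ (divisorTuples (m ∘ suc)) λ d → F zero d₀ * ∏ (λ i → F (suc i) (d i)))
    ≈⟨ ∑-cartesianProductWith _ (divisors (m zero)) (divisorTuples (m ∘ suc)) ⟨
  ∑ (divisorTuples m) (λ d → ∏ (λ i → F i (d i)))
    ∎

-- Rationals in ℂ

ℚ⇒ℂ-+ : ∀ p q → ℚ⇒ℂ (p ℚ.+ q) ≈ ℚ⇒ℂ p + ℚ⇒ℂ q
ℚ⇒ℂ-+ p q = mk≈ (pointwise λ _ → refl) (pointwise λ _ → refl)

ℚ⇒ℂ-* : ∀ p q → ℚ⇒ℂ (p ℚ.* q) ≈ ℚ⇒ℂ p * ℚ⇒ℂ q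
ℚ⇒ℂ-* p q = mk≈
  (pointwise λ _ → solve 2 (λ p q → p :* q := p :* q :- con 0ℚ :* con 0ℚ) refl p q)
  (pointwise λ _ → solve 2 (λ p q → con 0ℚ := p :* con 0ℚ :+ con 0ℚ :* q) refl p q)

-- Fractions are kept in lowest terms, so the identity is checked on unnormalised rationals, where
-- numerators and denominators multiply separately.
/-*-/ : ∀ i m j n .{{_ : NonZero m}} .{{_ : NonZero n}} →
  (i ℚ./ m) ℚ.* (j ℚ./ n) ≡ ((i ℤ.* j) ℚ./ (m ℕ.* n)) {{ℕₚ.m*n≢0 m n}}
/-*-/ i m@(ℕ.suc m-1) j n@(ℕ.suc n-1) = ℚₚ.toℚᵘ-injective
  (ℚᵘₚ.≃-trans (ℚₚ.toℚᵘ-homo-* (i ℚ./ m) (j ℚ./ n))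
  (ℚᵘₚ.≃-trans (ℚᵘₚ.*-cong (ℚₚ.toℚᵘ-fromℚᵘ (ℚᵘ.mkℚᵘ i m-1)) (ℚₚ.toℚᵘ-fromℚᵘ (ℚᵘ.mkℚᵘ j n-1)))
               (ℚᵘₚ.≃-sym (ℚₚ.toℚᵘ-fromℚᵘ (ℚᵘ.mkℚᵘ i m-1 ℚᵘ.* ℚᵘ.mkℚᵘ j n-1)))))

suc/1 : ∀ n → ℤ.+ ℕ.suc n ℚ./ 1 ≡ 1ℚ ℚ.+ (ℤ.+ n ℚ./ 1)
suc/1 n = ℚₚ.toℚᵘ-injective
  (ℚᵘₚ.≃-trans (ℚₚ.toℚᵘ-fromℚᵘ (ℚᵘ.mkℚᵘ (ℤ.+ ℕ.suc n) 0))
  (ℚᵘₚ.≃-trans (ℚᵘ.*≡* (cong (λ i → (ℤ.+ 1 ℤ.+ i) ℤ.* ℤ.+ 1) (≡.sym (ℤₚ.*-identityʳ (ℤ.+ n)))))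
  (ℚᵘₚ.≃-trans (ℚᵘₚ.+-congʳ ℚᵘ.1ℚᵘ (ℚᵘₚ.≃-sym (ℚₚ.toℚᵘ-fromℚᵘ (ℚᵘ.mkℚᵘ (ℤ.+ n) 0))))
               (ℚᵘₚ.≃-sym (ℚₚ.toℚᵘ-homo-+ 1ℚ (ℤ.+ n ℚ./ 1))))))

∑-one : ∀ (xs : List A) → ∑ xs (const 1#) ≈ ℕ⇒ℂ (length xs)
∑-one []       = ≈-refl
∑-one (x ∷ xs) = begin
  1# + ∑ xs (const 1#)       ≈⟨ +-congˡ (∑-one xs) ⟩
  1# + ℕ⇒ℂ (length xs)       ≈⟨ ℚ⇒ℂ-+ 1ℚ (ℤ.+ length xs ℚ./ 1) ⟨
  ℚ⇒ℂ (1ℚ ℚ.+ (ℤ.+ length xs ℚ./ 1)) ≡⟨ cong ℚ⇒ℂ (suc/1 (length xs)) ⟨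
  ℕ⇒ℂ (length (x ∷ xs)) ∎

1/-*⁺ : ∀ a b → 1/ (a *⁺ b) ≈ 1/ a * 1/ b
1/-*⁺ (pos a) (pos b) = trans
  (reflexive (cong ℚ⇒ℂ (≡.sym (/-*-/ (ℤ.+ 1) a (ℤ.+ 1) b))))
  (ℚ⇒ℂ-* (ℤ.+ 1 ℚ./ a) (ℤ.+ 1 ℚ./ b))

n/n≡1 : ∀ n .{{_ : NonZero n}} → ℤ.+ n ℚ./ n ≡ 1ℚ
n/n≡1 n@(ℕ.suc n-1) = ℚₚ.fromℚᵘ-cong {ℚᵘ.mkℚᵘ (ℤ.+ n) n-1} {ℚᵘ.1ℚᵘ}
  (ℚᵘ.*≡* (ℤₚ.*-comm (ℤ.+ n) (ℤ.+ 1)))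

1/n*n≈1 : ∀ n → 1/ n * ℕ⇒ℂ (value n) ≈ 1#
1/n*n≈1 (pos n) = trans (sym (ℚ⇒ℂ-* (ℤ.+ 1 ℚ./ n) (ℤ.+ n ℚ./ 1)))
  (reflexive (cong ℚ⇒ℂ (≡.trans (/-*-/ (ℤ.+ 1) n (ℤ.+ n) 1)
    (≡.trans (ℚₚ./-cong {{ℕₚ.m*n≢0 n 1}} (ℤₚ.*-identityˡ (ℤ.+ n)) (ℕₚ.*-identityʳ n)) (n/n≡1 n)))))

-- Positive integers and means of divisibility indicators

≡⁺ : ∀ {a b} → value a ≡ value b → a ≡ b
≡⁺ {pos a} {pos .a} refl = refl

∣⁺⇒≤ : ∀ d n → d ∣⁺ n → value d ℕ.≤ value n
∣⁺⇒≤ _ (pos n) = ∣.∣⇒≤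

quotient⁺ : ∀ d n → d ∣⁺ n → ∃ λ q → n ≡ d *⁺ q
quotient⁺ d n@(pos _) d∣n = pos (∣.quotient d∣n) {{∣.quotient≢0 d∣n}} , ≡⁺ (∣.m∣n⇒n≡m*quotient d∣n)

*⁺-cancelˡ : ∀ d {a b} → d *⁺ a ≡ d *⁺ b → a ≡ b
*⁺-cancelˡ (pos d) eq = ≡⁺ (ℕₚ.*-cancelˡ-≡ _ _ d (cong value eq))

1…-unique : ∀ n → Unique (1… n)
1…-unique n = map⁺ (ℕₚ.suc-injective ∘ cong value) (upTo⁺ (value n))

∈-1…⁺ : ∀ {k} n → value k ℕ.≤ value n → k ∈ 1… n
∈-1…⁺ {pos (ℕ.suc k)} n k<n = ∈-map⁺ _ (∈-upTo⁺ k<n)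

∈-1…⁻ : ∀ {k} n → k ∈ 1… n → value k ℕ.≤ value n
∈-1…⁻ n k∈ with _ , i∈ , refl ← ∈-map⁻ _ k∈ = ∈-upTo⁻ i∈

length-1… : ∀ n → length (1… n) ≡ value n
length-1… n = ≡.trans (length-map _ (upTo (value n))) (length-upTo (value n))

-- The multiples of `d` up to `dq` are the `dj` with `j` up to `q`, so `d *⁺_` reindexes them by
-- `1… q`.
∑-multiples : ∀ d q → ∑ (1… (d *⁺ q)) (λ k → 𝟙 (d ∣⁺? k)) ≈ ℕ⇒ℂ (value q)
∑-multiples d@(pos _) q = begin
  ∑ (1… (d *⁺ q)) (λ k → 𝟙 (d ∣⁺? k))          ≈⟨ ∑-cong (1… (d *⁺ q)) (λ _ → *-identityʳ _) ⟨
  ∑ (1… (d *⁺ q)) (λ k → 𝟙 (d ∣⁺? k) * 1#)     ≈⟨ ∑-filter (d ∣⁺?_) (1… (d *⁺ q)) ⟨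
  ∑ (filter (d ∣⁺?_) (1… (d *⁺ q))) (const 1#)  ≈⟨ ∑-reindex (d *⁺_)
    (1…-unique q) (filter⁺ (d ∣⁺?_) (1…-unique (d *⁺ q)))
    (λ {j} j∈ → ∈-filter⁺ (d ∣⁺?_) (∈-1…⁺ (d *⁺ q) (ℕₚ.*-monoʳ-≤ (value d) (∈-1…⁻ q j∈))) (∣.m∣m*n (value j)))
    (λ _ _ → *⁺-cancelˡ d) surj ⟩
  ∑ (1… q) (const 1#)                            ≈⟨ ∑-one (1… q) ⟩
  ℕ⇒ℂ (length (1… q))                            ≡⟨ cong ℕ⇒ℂ (length-1… q) ⟩
  ℕ⇒ℂ (value q)                                  ∎
  where
  surj : ∀ {k} → k ∈ filter (d ∣⁺?_) (1… (d *⁺ q)) → ∃ λ j → j ∈ 1… q × k ≡ d *⁺ j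
  surj {k} k∈ with k∈1… , d∣k ← ∈-filter⁻ (d ∣⁺?_) {xs = 1… (d *⁺ q)} k∈ with j , refl ← quotient⁺ d k d∣k =
    j , ∈-1…⁺ q (ℕₚ.*-cancelˡ-≤ (value d) (∈-1…⁻ (d *⁺ q) k∈1…)) , refl

mean-multiples : ∀ d n → d ∣⁺ n → 1/ n * ∑ (1… n) (λ k → 𝟙 (d ∣⁺? k)) ≈ 1/ d
mean-multiples d n d∣n with q , refl ← quotient⁺ d n d∣n = begin
  1/ (d *⁺ q) * ∑ (1… (d *⁺ q)) (λ k → 𝟙 (d ∣⁺? k)) ≈⟨ *-cong (1/-*⁺ d q) (∑-multiples d q) ⟩
  1/ d * 1/ q * ℕ⇒ℂ (value q)                         ≈⟨ *-assoc _ _ _ ⟩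
  1/ d * (1/ q * ℕ⇒ℂ (value q))                       ≈⟨ *-congˡ (1/n*n≈1 q) ⟩
  1/ d * 1#                                            ≈⟨ *-identityʳ _ ⟩
  1/ d                                                 ∎

-- By linearity the mean acts on one indicator at a time. The index type is arbitrary because both
-- divisor tuples and pairs of them are averaged in this way.
mean-∑ : ∀ (xs : List A) (L : A → ℕ⁺) {c : A → ℂ} n → (∀ x → L x ∣⁺ n) →
  1/ n * ∑ (1… n) (λ k → ∑ xs (λ x → 𝟙 (L x ∣⁺? k) * c x)) ≈ ∑ xs (λ x → c x * 1/ L x)
mean-∑ xs L {c} n L∣n = begin
  1/ n * ∑ (1… n) (λ k → ∑ xs (λ x → 𝟙 (L x ∣⁺? k) * c x)) ≈⟨ *-congˡ (∑-swap (1… n) xs) ⟩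
  1/ n * ∑ xs (λ x → ∑ (1… n) (λ k → 𝟙 (L x ∣⁺? k) * c x)) ≈⟨ *-∑ xs ⟩
  ∑ xs (λ x → 1/ n * ∑ (1… n) (λ k → 𝟙 (L x ∣⁺? k) * c x)) ≈⟨ ∑-cong xs (λ x → begin
    1/ n * ∑ (1… n) (λ k → 𝟙 (L x ∣⁺? k) * c x)  ≈⟨ *-congˡ (∑-* (1… n)) ⟨
    1/ n * (∑ (1… n) (λ k → 𝟙 (L x ∣⁺? k)) * c x)  ≈⟨ *-assoc _ _ _ ⟨
    1/ n * ∑ (1… n) (λ k → 𝟙 (L x ∣⁺? k)) * c x  ≈⟨ *-congʳ (mean-multiples (L x) n (L∣n x)) ⟩
    1/ L x * c x  ≈⟨ *-comm _ _ ⟩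
    c x * 1/ L x  ∎) ⟩
  ∑ xs (λ x → c x * 1/ L x) ∎

-- Divisor sums and Ramanujan-type functions

infixl 7 _÷_

-- Total: n ÷ d is 1 when d does not divide n.
_÷_ : ℕ⁺ → ℕ⁺ → ℕ⁺
n ÷ d with d ∣⁺? n
... | yes d∣n = n / d ⟨ d∣n ⟩
... | no  _   = 1⁺

/≡÷ : ∀ n d (d∣n : d ∣⁺ n) → n / d ⟨ d∣n ⟩ ≡ n ÷ d
/≡÷ n d d∣n with d ∣⁺? n
... | yes _   = refl
... | no  d∤n = ⊥-elim (d∤n d∣n)

/-unique : ∀ n d q (d∣n : d ∣⁺ n) → n ≡ d *⁺ q → n / d ⟨ d∣n ⟩ ≡ q
/-unique (pos n) (pos d) (pos q) _ n≡dq = ≡⁺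
  (≡.trans (DivMod./-congˡ {o = d} (≡.trans (cong value n≡dq) (ℕₚ.*-comm d q))) (DivMod.m*n/n≡m q d))

÷-unique : ∀ n d q → n ≡ d *⁺ q → n ÷ d ≡ q
÷-unique n d q n≡dq = ≡.trans (≡.sym (/≡÷ n d d∣n)) (/-unique n d q d∣n n≡dq)
  where d∣n = subst (d ∣⁺_) (≡.sym n≡dq) (∣.m∣m*n (value q))

divs : ℕ⁺ → List ℕ⁺
divs n = filter (_∣⁺? n) (1… n)

divs-unique : ∀ n → Unique (divs n)
divs-unique n = filter⁺ (_∣⁺? n) (1…-unique n)

∈-divs⁺ : ∀ {d} n → d ∣⁺ n → d ∈ divs n
∈-divs⁺ {d} n d∣n = ∈-filter⁺ (_∣⁺? n) (∈-1…⁺ n (∣⁺⇒≤ d n d∣n)) d∣n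

∈-divs⁻ : ∀ {d} n → d ∈ divs n → d ∣⁺ n
∈-divs⁻ n d∈ = proj₂ (∈-filter⁻ (_∣⁺? n) {xs = 1… n} d∈)

∑-divisors : ∀ n {F : ℕ⁺ → ℂ} → ∑ (divisors n) (F ∘ proj₁) ≡ ∑ (divs n) F
∑-divisors n = ∑-mapMaybe (_∣⁺? n) (1… n)

-- Using `÷` keeps divisibility proofs out, so the same function of `d` can be summed over the
-- divisors of `gcd(k,n)` and over those of `n`.
summand : (g h : ℕ⁺ → ℂ) → ℕ⁺ → ℕ⁺ → ℂ
summand g h n d = g d * h (n ÷ d)

ramanujan-gcd : ∀ g h k n → ramanujan g h k n ≈ ∑ (divs (gcd⁺ k n)) (summand g h n)
ramanujan-gcd g h k n = trans
  (∑-cong (divisors (gcd⁺ k n)) λ (d , d∣gcd) → *-congˡ (reflexive (cong h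
    (/≡÷ n d (∣.∣-trans d∣gcd (GCD.gcd[m,n]∣n (value k) (value n)))))))
  (reflexive (∑-divisors (gcd⁺ k n)))

∣gcd⇔ : ∀ k n d → d ∣⁺ gcd⁺ k n ⇔ (d ∣⁺ n × d ∣⁺ k)
∣gcd⇔ k n d = mk⇔
  (λ d∣ → ∣.∣-trans d∣ (GCD.gcd[m,n]∣n (value k) (value n)) , ∣.∣-trans d∣ (GCD.gcd[m,n]∣m (value k) (value n)))
  (λ (d∣n , d∣k) → GCD.gcd-greatest d∣k d∣n)

-- The divisors of `gcd(k,n)` are those divisors of `n` that divide `k`. Turning the second
-- condition into an indicator makes the range of summation independent of `k`.
ramanujan-divs : ∀ g h k n →
  ramanujan g h k n ≈ ∑ (divs n) (λ d → 𝟙 (d ∣⁺? k) * summand g h n d)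
ramanujan-divs g h k n = begin
  ramanujan g h k n                                ≈⟨ ramanujan-gcd g h k n ⟩
  ∑ (divs (gcd⁺ k n)) (summand g h n)          ≈⟨ ∑-sameElements (divs-unique (gcd⁺ k n))
                                                        (filter⁺ (_∣⁺? k) (divs-unique n)) (mk⇔ to from) ⟩
  ∑ (filter (_∣⁺? k) (divs n)) (summand g h n) ≈⟨ ∑-filter (_∣⁺? k) (divs n) ⟩
  ∑ (divs n) (λ d → 𝟙 (d ∣⁺? k) * summand g h n d) ∎
  where
  to : ∀ {d} → d ∈ divs (gcd⁺ k n) → d ∈ filter (_∣⁺? k) (divs n)
  to {d} d∈ with d∣n , d∣k ← Equivalence.to (∣gcd⇔ k n d) (∈-divs⁻ (gcd⁺ k n) d∈) =
    ∈-filter⁺ (_∣⁺? k) (∈-divs⁺ n d∣n) d∣k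

  from : ∀ {d} → d ∈ filter (_∣⁺? k) (divs n) → d ∈ divs (gcd⁺ k n)
  from {d} d∈ with d∈n , d∣k ← ∈-filter⁻ (_∣⁺? k) {xs = divs n} d∈ =
    ∈-divs⁺ (gcd⁺ k n) (Equivalence.from (∣gcd⇔ k n d) (∈-divs⁻ n d∈n , d∣k))

ramanujan-divisors : ∀ g h k n → ramanujan g h k n ≈
  ∑ (divisors n) (λ (d , d∣n) → 𝟙 (d ∣⁺? k) * (g d * h (n / d ⟨ d∣n ⟩)))
ramanujan-divisors g h k n = begin
  ramanujan g h k n                                    ≈⟨ ramanujan-divs g h k n ⟩
  ∑ (divs n) (λ d → 𝟙 (d ∣⁺? k) * summand g h n d) ≡⟨ ∑-divisors n ⟨
  ∑ (divisors n) (λ (d , _) → 𝟙 (d ∣⁺? k) * summand g h n d)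
    ≈⟨ ∑-cong (divisors n) (λ (d , d∣n) → *-congˡ (*-congˡ (reflexive (cong h (/≡÷ n d d∣n))))) ⟨
  ∑ (divisors n) (λ (d , d∣n) → 𝟙 (d ∣⁺? k) * (g d * h (n / d ⟨ d∣n ⟩))) ∎

-- Products of Ramanujan-type functions and the first representation

lcm⁺∣⇔ : ∀ a b k → (a ∣⁺ k × b ∣⁺ k) ⇔ lcm⁺ a b ∣⁺ k
lcm⁺∣⇔ a b k = mk⇔ (uncurry LCM.lcm-least)
  λ l∣k → ∣.∣-trans (LCM.m∣lcm[m,n] (value a) (value b)) l∣k , ∣.∣-trans (LCM.n∣lcm[m,n] (value a) (value b)) l∣k

-- All `dᵢ` divide `k` exactly when their lcm does; for the empty family the lcm is 1, which divides
-- `k`.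
∏-𝟙 : (d : Fin r → ℕ⁺) (k : ℕ⁺) → ∏ (λ i → 𝟙 (d i ∣⁺? k)) ≈ 𝟙 (Lcm d ∣⁺? k)
∏-𝟙 {ℕ.zero}  d k = reflexive (cong (if_then 1# else 0#) (≡.sym (dec-true (1⁺ ∣⁺? k) (∣.1∣ value k))))
∏-𝟙 {ℕ.suc r} d k = begin
  𝟙 (d zero ∣⁺? k) * ∏ (λ i → 𝟙 (d (suc i) ∣⁺? k))       ≈⟨ *-congˡ (∏-𝟙 (d ∘ suc) k) ⟩
  𝟙 (d zero ∣⁺? k) * 𝟙 (Lcm (d ∘ suc) ∣⁺? k)             ≈⟨ 𝟙-× (d zero ∣⁺? k) (Lcm (d ∘ suc) ∣⁺? k) ⟨
  𝟙 ((d zero ∣⁺? k) ×-dec (Lcm (d ∘ suc) ∣⁺? k))         ≡⟨ 𝟙-cong (lcm⁺∣⇔ (d zero) (Lcm (d ∘ suc)) k)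
                                                               ((d zero ∣⁺? k) ×-dec (Lcm (d ∘ suc) ∣⁺? k)) (Lcm d ∣⁺? k) ⟩
  𝟙 (Lcm d ∣⁺? k) ∎

∣Lcm : (m : Fin r → ℕ⁺) → ∀ i → m i ∣⁺ Lcm m
∣Lcm m zero    = LCM.m∣lcm[m,n] (value (m zero)) (value (Lcm (m ∘ suc)))
∣Lcm m (suc i) = ∣.∣-trans (∣Lcm (m ∘ suc) i) (LCM.n∣lcm[m,n] (value (m zero)) (value (Lcm (m ∘ suc))))

Lcm-least : (d : Fin r → ℕ⁺) (k : ℕ⁺) → (∀ i → d i ∣⁺ k) → Lcm d ∣⁺ k
Lcm-least {ℕ.zero}  d k d∣k = ∣.1∣ value k
Lcm-least {ℕ.suc r} d k d∣k = LCM.lcm-least (d∣k zero) (Lcm-least (d ∘ suc) k (d∣k ∘ suc))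

values : (m : Fin r → ℕ⁺) → (∀ i → Divisor (m i)) → Fin r → ℕ⁺
values m d i = proj₁ (d i)

coefficient : (g h : ℕ⁺ → ℂ) (m : Fin r → ℕ⁺) → (∀ i → Divisor (m i)) → ℂ
coefficient g h m d =
  ∏ (λ i → g (proj₁ (d i))) * ∏ (λ i → h (m i / proj₁ (d i) ⟨ proj₂ (d i) ⟩))

-- After expansion `k` survives only in one indicator per tuple, the form to which `mean-∑` applies.
∏-ramanujan : ∀ g h k (m : Fin r → ℕ⁺) → ∏ (λ i → ramanujan g h k (m i)) ≈
  ∑ (divisorTuples m) (λ d → 𝟙 (Lcm (values m d) ∣⁺? k) * coefficient g h m d)
∏-ramanujan g h k m = begin
  ∏ (λ i → ramanujan g h k (m i)) ≈⟨ ∏-cong (λ i → ramanujan-divisors g h k (m i)) ⟩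
  ∏ (λ i → ∑ (divisors (m i)) λ (d , d∣m) → 𝟙 (d ∣⁺? k) * (g d * h (m i / d ⟨ d∣m ⟩)))
    ≈⟨ ∏-∑-divisors m ⟩
  ∑ (divisorTuples m) (λ d → ∏ λ i →
    𝟙 (proj₁ (d i) ∣⁺? k) * (g (proj₁ (d i)) * h (m i / proj₁ (d i) ⟨ proj₂ (d i) ⟩)))
    ≈⟨ ∑-cong (divisorTuples m) (λ d → trans (∏-* (λ i → 𝟙 (values m d i ∣⁺? k)) _)
         (*-cong (∏-𝟙 (values m d) k) (∏-* (g ∘ values m d) (λ i → h (m i / values m d i ⟨ proj₂ (d i) ⟩))))) ⟩
  ∑ (divisorTuples m) (λ d → 𝟙 (Lcm (values m d) ∣⁺? k) * coefficient g h m d) ∎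

average-divisorTuples : ∀ g h (m : Fin r → ℕ⁺) → average (ramanujan g h) m ≈
  ∑ (divisorTuples m) (λ d → coefficient g h m d * 1/ Lcm (values m d))
average-divisorTuples g h m = trans
  (*-congˡ (∑-cong (1… (Lcm m)) λ k → ∏-ramanujan g h k m))
  (mean-∑ (divisorTuples m) (Lcm ∘ values m) (Lcm m)
    -- The lcm of a tuple divides `Lcm m`, so `1… (Lcm m)` covers whole periods of its indicator.
    λ d → Lcm-least (values m d) (Lcm m) λ i → ∣.∣-trans (proj₂ (d i)) (∣Lcm m i))

-- Grouping by the gcd

_≟⁺_ : (a b : ℕ⁺) → Dec (a ≡ b)
a ≟⁺ b = map′ ≡⁺ (cong value) (value a ℕₚ.≟ value b)

-- Insert `F (γ x) = ∑ [γ x = y] F y` and exchange the sums; the inner sum over `xs` counts the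
-- fibre above `y`.
∑-fibres : ∀ (xs : List A) {ys : List ℕ⁺} (γ : A → ℕ⁺) → Unique ys → (∀ {x} → x ∈ xs → γ x ∈ ys) → ∀ F →
  ∑ xs (F ∘ γ) ≈ ∑ ys (λ y → F y * ∑ (filter (λ x → γ x ≟⁺ y) xs) (const 1#))
∑-fibres xs {ys} γ ys! γ∈ F = begin
  ∑ xs (F ∘ γ)
    ≈⟨ ∑-cong-∈ xs (λ x∈ → trans (sym (+-identityʳ _)) (single (γ∈ x∈))) ⟩
  ∑ xs (λ x → ∑ ys (λ y → 𝟙 (γ x ≟⁺ y) * F y))
    ≈⟨ ∑-swap xs ys ⟩
  ∑ ys (λ y → ∑ xs (λ x → 𝟙 (γ x ≟⁺ y) * F y))
    ≈⟨ ∑-cong ys (λ y → trans (sym (∑-* xs)) (trans (*-comm _ _) (*-congˡ (count y)))) ⟩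
  ∑ ys (λ y → F y * ∑ (filter (λ x → γ x ≟⁺ y) xs) (const 1#)) ∎
  where
  -- As `ys` has no duplicates, filtering it by equality with its member `z` leaves just `z`.
  single : ∀ {z} → z ∈ ys → ∑ (z ∷ []) F ≈ ∑ ys (λ y → 𝟙 (z ≟⁺ y) * F y)
  single {z} z∈ = trans
    (∑-sameElements ([] ∷ []) (filter⁺ (z ≟⁺_) ys!)
      (mk⇔ (λ { (here refl) → ∈-filter⁺ (z ≟⁺_) z∈ refl })
           (λ y∈ → here (≡.sym (proj₂ (∈-filter⁻ (z ≟⁺_) {xs = ys} y∈))))))
    (∑-filter (z ≟⁺_) ys)

  count : ∀ y → ∑ xs (λ x → 𝟙 (γ x ≟⁺ y)) ≈ ∑ (filter (λ x → γ x ≟⁺ y) xs) (const 1#)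
  count y = sym (trans (∑-filter (λ x → γ x ≟⁺ y) xs) (∑-cong xs λ _ → *-identityʳ _))

-- Here `gcd(dj,dq) = d gcd(j,q)`, and `d` cancels.
gcd[dj,dq]≡d⇔coprime : ∀ d j q → gcd⁺ (d *⁺ j) (d *⁺ q) ≡ d ⇔ Coprime (value j) (value q)
gcd[dj,dq]≡d⇔coprime d@(pos d′) j q = mk⇔ to from
  where
  scale : d′ ℕ.* GCD.gcd (value j) (value q) ≡ GCD.gcd (d′ ℕ.* value j) (d′ ℕ.* value q)
  scale = GCD.c*gcd[m,n]≡gcd[cm,cn] d′ (value j) (value q)

  to : gcd⁺ (d *⁺ j) (d *⁺ q) ≡ d → Coprime (value j) (value q)
  to eq = gcd≡1⇒coprime (ℕₚ.*-cancelˡ-≡ _ _ d′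
    (≡.trans scale (≡.trans (cong value eq) (≡.sym (ℕₚ.*-identityʳ d′)))))

  from : Coprime (value j) (value q) → gcd⁺ (d *⁺ j) (d *⁺ q) ≡ d
  from c = ≡⁺ (≡.trans (≡.sym scale)
    (≡.trans (cong (d′ ℕ.*_) (coprime⇒gcd≡1 c)) (ℕₚ.*-identityʳ d′)))

-- The `k` up to `n` with `gcd(k,n) = d` are the `dj` with `j` up to `q` and coprime to `q`, exactly
-- what `φ q` counts.
∑-gcd≡ : ∀ n d q → n ≡ d *⁺ q →
  ∑ (filter (λ k → gcd⁺ k n ≟⁺ d) (1… n)) (const 1#) ≈ ℕ⇒ℂ (φ q)
∑-gcd≡ _ d@(pos _) q refl = trans
  (∑-reindex (d *⁺_) (filter⁺ cop? (1…-unique q)) (filter⁺ gcd? (1…-unique dq)) to (λ _ _ → *⁺-cancelˡ d) surj)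
  (∑-one (filter cop? (1… q)))
  where
  dq = d *⁺ q

  gcd? : Decidable (λ k → gcd⁺ k dq ≡ d)
  gcd? k = gcd⁺ k dq ≟⁺ d

  cop? : Decidable (λ j → Coprime (value j) (value q))
  cop? j = coprime? (value j) (value q)

  to : ∀ {j} → j ∈ filter cop? (1… q) → d *⁺ j ∈ filter gcd? (1… dq)
  to {j} j∈ with j≤q , cop ← ∈-filter⁻ cop? {xs = 1… q} j∈ =
    ∈-filter⁺ gcd? (∈-1…⁺ dq (ℕₚ.*-monoʳ-≤ (value d) (∈-1…⁻ q j≤q)))
      (Equivalence.from (gcd[dj,dq]≡d⇔coprime d j q) cop)

  surj : ∀ {k} → k ∈ filter gcd? (1… dq) → ∃ λ j → j ∈ filter cop? (1… q) × k ≡ d *⁺ j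
  surj {k} k∈ with k≤dq , gcd≡d ← ∈-filter⁻ gcd? {xs = 1… dq} k∈
    with j , refl ← quotient⁺ d k (subst (_∣⁺ k) gcd≡d (GCD.gcd[m,n]∣m (value k) (value dq))) =
      j , ∈-filter⁺ cop? (∈-1…⁺ q (ℕₚ.*-cancelˡ-≤ (value d) (∈-1…⁻ dq k≤dq)))
            (Equivalence.to (gcd[dj,dq]≡d⇔coprime d j q) gcd≡d) , refl

∑-gcd : ∀ n (F : ℕ⁺ → ℂ) → ∑ (1… n) (λ k → F (gcd⁺ k n)) ≈
  ∑ (divisors n) (λ (d , d∣n) → F d * ℕ⇒ℂ (φ (n / d ⟨ d∣n ⟩)))
∑-gcd n F = begin
  ∑ (1… n) (λ k → F (gcd⁺ k n))
    ≈⟨ ∑-fibres (1… n) (λ k → gcd⁺ k n) (divs-unique n)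
         (λ {k} _ → ∈-divs⁺ n (GCD.gcd[m,n]∣n (value k) (value n))) F ⟩
  ∑ (divs n) (λ d → F d * ∑ (filter (λ k → gcd⁺ k n ≟⁺ d) (1… n)) (const 1#))
    ≡⟨ ∑-divisors n {λ d → F d * ∑ (filter (λ k → gcd⁺ k n ≟⁺ d) (1… n)) (const 1#)} ⟨
  ∑ (divisors n) (λ (d , _) → F d * ∑ (filter (λ k → gcd⁺ k n ≟⁺ d) (1… n)) (const 1#))
    ≈⟨ ∑-cong (divisors n) (λ (d , d∣n) → *-congˡ (totient d d∣n)) ⟩
  ∑ (divisors n) (λ (d , d∣n) → F d * ℕ⇒ℂ (φ (n / d ⟨ d∣n ⟩))) ∎
  where
  totient : ∀ d (d∣n : d ∣⁺ n) →
    ∑ (filter (λ k → gcd⁺ k n ≟⁺ d) (1… n)) (const 1#) ≈ ℕ⇒ℂ (φ (n / d ⟨ d∣n ⟩))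
  totient d d∣n = subst
    (λ e → ∑ (filter (λ k → gcd⁺ k n ≟⁺ d) (1… n)) (const 1#) ≈ ℕ⇒ℂ (φ e))
    (≡.sym (/-unique n d q d∣n n≡dq)) (∑-gcd≡ n d q n≡dq)
    where
    q = proj₁ (quotient⁺ d n d∣n)
    n≡dq = proj₂ (quotient⁺ d n d∣n)

gcd-gcd : ∀ k {m n} → n ∣⁺ m → gcd⁺ (gcd⁺ k m) n ≡ gcd⁺ k n
gcd-gcd k {m} {n} n∣m = ≡⁺ (∣.∣-antisym
  (GCD.gcd-greatest (∣.∣-trans ∣gcd[k,m] (GCD.gcd[m,n]∣m (value k) (value m))) ∣n)
  (GCD.gcd-greatest (GCD.gcd-greatest (GCD.gcd[m,n]∣m (value k) (value n))
                                      (∣.∣-trans (GCD.gcd[m,n]∣n (value k) (value n)) n∣m))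
                    (GCD.gcd[m,n]∣n (value k) (value n))))
  where
  ∣gcd[k,m] = GCD.gcd[m,n]∣m (GCD.gcd (value k) (value m)) (value n)
  ∣n        = GCD.gcd[m,n]∣n (GCD.gcd (value k) (value m)) (value n)

-- The value depends on `k` only through `gcd(k,n)`, which for `n ∣ m` does not change when `k` is
-- replaced by `gcd(k,m)`.
ramanujan-periodic : ∀ g h k m n → n ∣⁺ m → ramanujan g h k n ≈ ramanujan g h (gcd⁺ k m) n
ramanujan-periodic g h k m n n∣m = trans (ramanujan-gcd g h k n) (trans
  (reflexive (cong (λ e → ∑ (divs e) (summand g h n)) (≡.sym (gcd-gcd k {m} {n} n∣m))))
  (sym (ramanujan-gcd g h (gcd⁺ k m) n)))

average-divisors : ∀ g h (m : Fin r → ℕ⁺) → average (ramanujan g h) m ≈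
  1/ Lcm m * ∑ (divisors (Lcm m)) (λ (d , d∣m) →
    ∏ (λ i → ramanujan g h d (m i)) * ℕ⇒ℂ (φ (Lcm m / d ⟨ d∣m ⟩)))
average-divisors g h m = *-congˡ (trans
  -- Every `mᵢ` divides `Lcm m`, so the whole product becomes a function of `gcd⁺ k (Lcm m)`, as
  -- `∑-gcd` requires.
  (∑-cong (1… (Lcm m)) λ k → ∏-cong λ i → ramanujan-periodic g h k (Lcm m) (m i) (∣Lcm m i))
  (∑-gcd (Lcm m) (λ d → ∏ λ i → ramanujan g h d (m i))))

-- Multiplicativity

*⁺-cancelˡ-∣ : ∀ d {a b} → value d ℕ.* a ∣.∣ value d ℕ.* b → a ∣.∣ b
*⁺-cancelˡ-∣ (pos d) = ∣.*-cancelˡ-∣ d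

Coprime-∣ : ∀ {a b m n} → a ∣.∣ m → b ∣.∣ n → Coprime m n → Coprime a b
Coprime-∣ a∣m b∣n c (d∣a , d∣b) = c (∣.∣-trans d∣a a∣m , ∣.∣-trans d∣b b∣n)

-- Write `k = qa`: since `b` divides `qa` and is coprime to `a`, it divides `q`.
coprime-*-∣ : ∀ {a b k} → Coprime a b → a ∣.∣ k → b ∣.∣ k → a ℕ.* b ∣.∣ k
coprime-*-∣ {a} {b} c a∣k b∣k with ∣.divides-refl q ← a∣k =
  subst (a ℕ.* b ∣.∣_) (ℕₚ.*-comm a q) (∣.*-monoʳ-∣ a
    (coprime-divisor (Coprime.sym c) (subst (b ∣.∣_) (ℕₚ.*-comm q a) b∣k)))

coprime-*-∣⇔ : ∀ a b k → Coprime a b → (a ∣.∣ k × b ∣.∣ k) ⇔ (a ℕ.* b ∣.∣ k)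
coprime-*-∣⇔ a b k c = mk⇔ (λ (a∣k , b∣k) → coprime-*-∣ {a} {b} {k} c a∣k b∣k)
  (λ ab∣k → ∣.m*n∣⇒m∣ a b ab∣k , ∣.m*n∣⇒n∣ a b ab∣k)

𝟙-* : ∀ a b k → Coprime (value a) (value b) → 𝟙 (a *⁺ b ∣⁺? k) ≈ 𝟙 (a ∣⁺? k) * 𝟙 (b ∣⁺? k)
𝟙-* a b k c = trans
  (reflexive (≡.sym (𝟙-cong (coprime-*-∣⇔ (value a) (value b) (value k) c)
    ((a ∣⁺? k) ×-dec (b ∣⁺? k)) (a *⁺ b ∣⁺? k))))
  (𝟙-× (a ∣⁺? k) (b ∣⁺? k))

-- Coprimality makes `(a , b) ↦ ab` a bijection from pairs of divisors onto the divisors of the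
-- product.
∑-divs-* : ∀ m n → Coprime (value m) (value n) → ∀ {F} →
  ∑ (divs (m *⁺ n)) F ≈ ∑ (cartesianProduct (divs m) (divs n)) (λ (a , b) → F (a *⁺ b))
∑-divs-* m n c = ∑-reindex (uncurry _*⁺_)
  (cartesianProduct⁺ (divs-unique m) (divs-unique n)) (divs-unique (m *⁺ n)) to inj surj
  where
  pairs = cartesianProduct (divs m) (divs n)

  factors : ∀ {a b} → (a , b) ∈ pairs → a ∣⁺ m × b ∣⁺ n
  factors ab∈ with a∈ , b∈ ← ∈-cartesianProduct⁻ (divs m) (divs n) ab∈ = ∈-divs⁻ m a∈ , ∈-divs⁻ n b∈

  to : ∀ {ab} → ab ∈ pairs → uncurry _*⁺_ ab ∈ divs (m *⁺ n)
  to ab∈ with a∣m , b∣n ← factors ab∈ = ∈-divs⁺ (m *⁺ n) (∣.*-pres-∣ a∣m b∣n)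

  -- `a` divides `a′b′` and is coprime to `b′`, because `b′` divides `n`. Used in both directions,
  -- this gives `a ≡ a′`.
  left-∣ : ∀ {a b a′ b′} → a ∣⁺ m → b′ ∣⁺ n → a *⁺ b ≡ a′ *⁺ b′ → a ∣⁺ a′
  left-∣ {a} {b} {a′} {b′} a∣m b′∣n eq = coprime-divisor (Coprime-∣ a∣m b′∣n c)
    (subst (value a ∣.∣_) (≡.trans (cong value eq) (ℕₚ.*-comm (value a′) (value b′))) (∣.m∣m*n (value b)))

  inj : ∀ {ab ab′} → ab ∈ pairs → ab′ ∈ pairs → uncurry _*⁺_ ab ≡ uncurry _*⁺_ ab′ → ab ≡ ab′
  inj {a , b} {a′ , b′} ab∈ ab′∈ eq with a∣m , b∣n ← factors ab∈ with a′∣m , b′∣n ← factors ab′∈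
    with refl ← ≡⁺ {a} {a′} (∣.∣-antisym (left-∣ {a} {b} {a′} {b′} a∣m b′∣n eq)
                                           (left-∣ {a′} {b′} {a} {b} a′∣m b∣n (≡.sym eq)))
    = cong (a ,_) (*⁺-cancelˡ a eq)

  -- The preimage of `d` consists of `a = gcd(d,m)` and `b = d/a`.
  surj : ∀ {d} → d ∈ divs (m *⁺ n) → ∃ λ ab → ab ∈ pairs × d ≡ uncurry _*⁺_ ab
  surj {d} d∈ with a∣d ← GCD.gcd[m,n]∣m (value d) (value m) | a∣m ← GCD.gcd[m,n]∣n (value d) (value m)
    with b , d≡ab ← quotient⁺ (gcd⁺ d m) d a∣d | m′ , m≡am′ ← quotient⁺ (gcd⁺ d m) m a∣m =
      (a , b) , ∈-cartesianProduct⁺ (∈-divs⁺ m a∣m) (∈-divs⁺ n b∣n) , d≡ab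
    where
    a = gcd⁺ d m

    b⊥m′ : Coprime (value b) (value m′)
    b⊥m′ = Equivalence.to (gcd[dj,dq]≡d⇔coprime a b m′)
      (≡.sym (cong₂ gcd⁺ d≡ab m≡am′))

    -- Cancelling `a` in `ab ∣ am′n` gives `b ∣ m′n`, and `b` is coprime to `m′`.
    b∣n : b ∣⁺ n
    b∣n = coprime-divisor b⊥m′ (*⁺-cancelˡ-∣ a
      (subst (value a ℕ.* value b ∣.∣_) (ℕₚ.*-assoc (value a) (value m′) (value n))
        (subst (λ e → value a ℕ.* value b ∣.∣ e ℕ.* value n) (cong value m≡am′)
          (subst (λ e → value e ∣.∣ value m ℕ.* value n) d≡ab (∈-divs⁻ (m *⁺ n) d∈)))))

multiplicative-coprime : ∀ g → IsMultiplicative₁ g → ∀ m n →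
  Coprime (value m) (value n) → g (m *⁺ n) ≈ g m * g n
multiplicative-coprime g g-mult m n c = IsMultiplicative.homo g-mult (const m) (const n)
  -- For a one-entry family `∏⁺` is `m *⁺ 1⁺`, hence the removal of the factors 1.
  (≡⁺ (≡.trans (cong₂ GCD.gcd (ℕₚ.*-identityʳ (value m)) (ℕₚ.*-identityʳ (value n)))
               (coprime⇒gcd≡1 c)))

*⁺-interchange : ∀ a b c d → (a *⁺ b) *⁺ (c *⁺ d) ≡ (a *⁺ c) *⁺ (b *⁺ d)
*⁺-interchange a b c d = ≡⁺ (ℕ*.interchange (value a) (value b) (value c) (value d))
  where module ℕ* = CommutativeSemigroup ℕₚ.*-commutativeSemigroup

-- With `m = aa′` and `n = bb′` the complementary divisor of `ab` in `mn` is `a′b′`, and both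
-- `a , b` and `a′ , b′` inherit coprimality from `m , n`.
summand-* : ∀ g h → IsMultiplicative₁ g → IsMultiplicative₁ h →
  ∀ m n a b → Coprime (value m) (value n) → a ∣⁺ m → b ∣⁺ n →
  summand g h (m *⁺ n) (a *⁺ b) ≈ summand g h m a * summand g h n b
summand-* g h g-mult h-mult m n a b c a∣m b∣n
  with a′ , m≡aa′ ← quotient⁺ a m a∣m | b′ , n≡bb′ ← quotient⁺ b n b∣n = begin
  g (a *⁺ b) * h ((m *⁺ n) ÷ (a *⁺ b))
    ≡⟨ cong (λ e → g (a *⁺ b) * h e) (÷-unique (m *⁺ n) (a *⁺ b) (a′ *⁺ b′)
         (≡.trans (cong₂ _*⁺_ m≡aa′ n≡bb′) (*⁺-interchange a a′ b b′))) ⟩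
  g (a *⁺ b) * h (a′ *⁺ b′)
    ≈⟨ *-cong (multiplicative-coprime g g-mult a b (Coprime-∣ a∣m b∣n c))
              (multiplicative-coprime h h-mult a′ b′ (Coprime-∣ a′∣m b′∣n c)) ⟩
  g a * g b * (h a′ * h b′)
    ≈⟨ *.interchange _ _ _ _ ⟩
  g a * h a′ * (g b * h b′)
    ≡⟨ cong₂ (λ d e → g a * h d * (g b * h e)) (÷-unique m a a′ m≡aa′) (÷-unique n b b′ n≡bb′) ⟨
  summand g h m a * summand g h n b ∎
  where
  a′∣m : a′ ∣⁺ m
  a′∣m = ∣.divides (value a) (cong value m≡aa′)

  b′∣n : b′ ∣⁺ n
  b′∣n = ∣.divides (value b) (cong value n≡bb′)

-- For fixed `k`, each divisor of `mn` is `ab` with `a ∣ m` and `b ∣ n`, and the indicator and the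
-- summand both split along this factorisation.
ramanujan-* : ∀ g h → IsMultiplicative₁ g → IsMultiplicative₁ h →
  ∀ k m n → Coprime (value m) (value n) →
  ramanujan g h k (m *⁺ n) ≈ ramanujan g h k m * ramanujan g h k n
ramanujan-* g h g-mult h-mult k m n c = begin
  ramanujan g h k (m *⁺ n)
    ≈⟨ ramanujan-divs g h k (m *⁺ n) ⟩
  ∑ (divs (m *⁺ n)) (λ d → 𝟙 (d ∣⁺? k) * summand g h (m *⁺ n) d)
    ≈⟨ ∑-divs-* m n c {λ d → 𝟙 (d ∣⁺? k) * summand g h (m *⁺ n) d} ⟩
  ∑ (cartesianProduct (divs m) (divs n)) (λ (a , b) → 𝟙 (a *⁺ b ∣⁺? k) * summand g h (m *⁺ n) (a *⁺ b))
    ≈⟨ ∑-cong-∈ (cartesianProduct (divs m) (divs n)) (λ {(a , b)} → termwise a b) ⟩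
  ∑ (cartesianProduct (divs m) (divs n))
    (λ (a , b) → 𝟙 (a ∣⁺? k) * summand g h m a * (𝟙 (b ∣⁺? k) * summand g h n b))
    ≈⟨ ∑*∑ (divs m) (divs n) ⟨
  ∑ (divs m) (λ a → 𝟙 (a ∣⁺? k) * summand g h m a) * ∑ (divs n) (λ b → 𝟙 (b ∣⁺? k) * summand g h n b)
    ≈⟨ *-cong (ramanujan-divs g h k m) (ramanujan-divs g h k n) ⟨
  ramanujan g h k m * ramanujan g h k n ∎
  where
  termwise : ∀ a b → (a , b) ∈ cartesianProduct (divs m) (divs n) →
    𝟙 (a *⁺ b ∣⁺? k) * summand g h (m *⁺ n) (a *⁺ b) ≈
    𝟙 (a ∣⁺? k) * summand g h m a * (𝟙 (b ∣⁺? k) * summand g h n b)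
  termwise a b ab∈ with a∈ , b∈ ← ∈-cartesianProduct⁻ (divs m) (divs n) ab∈ = trans
    (*-cong (𝟙-* a b k (Coprime-∣ (∈-divs⁻ m a∈) (∈-divs⁻ n b∈) c))
            (summand-* g h g-mult h-mult m n a b c (∈-divs⁻ m a∈) (∈-divs⁻ n b∈)))
    (*.interchange _ _ _ _)

-- Multiplicativity of the average

∣∏⁺ : (m : Fin r → ℕ⁺) → ∀ i → m i ∣⁺ ∏⁺ m
∣∏⁺ m zero    = ∣.m∣m*n (value (∏⁺ (m ∘ suc)))
∣∏⁺ m (suc i) = ∣.∣-trans (∣∏⁺ (m ∘ suc) i) (∣.n∣m*n (value (m zero)))

-- The three averages run over different ranges. Evaluating the mean of each `[ll′ ∣ k]` as
-- `1/(ll′)` removes the range, and the sum over pairs then separates into the expansions of the two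
-- averages.
average-* : ∀ g h → IsMultiplicative₁ g → IsMultiplicative₁ h →
  (m n : Fin r → ℕ⁺) → gcd⁺ (∏⁺ m) (∏⁺ n) ≡ 1⁺ →
  average (ramanujan g h) (λ i → m i *⁺ n i) ≈ average (ramanujan g h) m * average (ramanujan g h) n
average-* g h g-mult h-mult m n gcd≡1 = begin
  1/ Lcm mn * ∑ (1… (Lcm mn)) (λ k → ∏ λ i → f k (mn i))
    ≈⟨ *-congˡ (∑-cong (1… (Lcm mn)) expand) ⟩
  1/ Lcm mn * ∑ (1… (Lcm mn)) (λ k → ∑ pairs λ (a , b) →
      𝟙 (Lcm (values m a) *⁺ Lcm (values n b) ∣⁺? k) * (coefficient g h m a * coefficient g h n b))
    ≈⟨ mean-∑ pairs (λ (a , b) → Lcm (values m a) *⁺ Lcm (values n b)) (Lcm mn) (λ (a , b) → divides a b) ⟩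
  ∑ pairs (λ (a , b) → coefficient g h m a * coefficient g h n b * 1/ (Lcm (values m a) *⁺ Lcm (values n b)))
    ≈⟨ ∑-cong pairs (λ (a , b) → trans
         (*-congˡ (1/-*⁺ (Lcm (values m a)) (Lcm (values n b)))) (*.interchange _ _ _ _)) ⟩
  ∑ pairs (λ (a , b) → coefficient g h m a * 1/ Lcm (values m a) * (coefficient g h n b * 1/ Lcm (values n b)))
    ≈⟨ ∑*∑ (divisorTuples m) (divisorTuples n) ⟨
  ∑ (divisorTuples m) (λ a → coefficient g h m a * 1/ Lcm (values m a)) *
  ∑ (divisorTuples n) (λ b → coefficient g h n b * 1/ Lcm (values n b))
    ≈⟨ *-cong (average-divisorTuples g h m) (average-divisorTuples g h n) ⟨
  average f m * average f n ∎
  where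
  f = ramanujan g h
  mn = λ i → m i *⁺ n i
  pairs = cartesianProduct (divisorTuples m) (divisorTuples n)

  ∏m⊥∏n : Coprime (value (∏⁺ m)) (value (∏⁺ n))
  ∏m⊥∏n = gcd≡1⇒coprime (cong value gcd≡1)

  -- The lcm of a divisor tuple divides the product of the `mᵢ`, or of the `nᵢ`, and these products
  -- are coprime.
  Lcm⊥Lcm : ∀ a b → Coprime (value (Lcm (values m a))) (value (Lcm (values n b)))
  Lcm⊥Lcm a b = Coprime-∣
    (Lcm-least (values m a) (∏⁺ m) λ i → ∣.∣-trans (proj₂ (a i)) (∣∏⁺ m i))
    (Lcm-least (values n b) (∏⁺ n) λ i → ∣.∣-trans (proj₂ (b i)) (∣∏⁺ n i)) ∏m⊥∏n

  divides : ∀ a b → Lcm (values m a) *⁺ Lcm (values n b) ∣⁺ Lcm mn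
  divides a b = coprime-*-∣ (Lcm⊥Lcm a b)
    (Lcm-least (values m a) (Lcm mn) λ i →
      ∣.∣-trans (proj₂ (a i)) (∣.∣-trans (∣.m∣m*n (value (n i))) (∣Lcm mn i)))
    (Lcm-least (values n b) (Lcm mn) λ i →
      ∣.∣-trans (proj₂ (b i)) (∣.∣-trans (∣.n∣m*n (value (m i))) (∣Lcm mn i)))

  expand : ∀ k → ∏ (λ i → f k (mn i)) ≈ ∑ pairs λ (a , b) →
    𝟙 (Lcm (values m a) *⁺ Lcm (values n b) ∣⁺? k) * (coefficient g h m a * coefficient g h n b)
  expand k = begin
    ∏ (λ i → f k (mn i))
      ≈⟨ ∏-cong (λ i → ramanujan-* g h g-mult h-mult k (m i) (n i) (Coprime-∣ (∣∏⁺ m i) (∣∏⁺ n i) ∏m⊥∏n)) ⟩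
    ∏ (λ i → f k (m i) * f k (n i))
      ≈⟨ ∏-* (λ i → f k (m i)) (λ i → f k (n i)) ⟩
    ∏ (λ i → f k (m i)) * ∏ (λ i → f k (n i))
      ≈⟨ *-cong (∏-ramanujan g h k m) (∏-ramanujan g h k n) ⟩
    ∑ (divisorTuples m) (λ a → 𝟙 (Lcm (values m a) ∣⁺? k) * coefficient g h m a) *
    ∑ (divisorTuples n) (λ b → 𝟙 (Lcm (values n b) ∣⁺? k) * coefficient g h n b)
      ≈⟨ ∑*∑ (divisorTuples m) (divisorTuples n) ⟩
    ∑ pairs (λ (a , b) → 𝟙 (Lcm (values m a) ∣⁺? k) * coefficient g h m a *
                          (𝟙 (Lcm (values n b) ∣⁺? k) * coefficient g h n b))
      ≈⟨ ∑-cong pairs (λ (a , b) → trans (*.interchange _ _ _ _)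
           (*-congʳ (sym (𝟙-* (Lcm (values m a)) (Lcm (values n b)) k (Lcm⊥Lcm a b))))) ⟩
    ∑ pairs (λ (a , b) → 𝟙 (Lcm (values m a) *⁺ Lcm (values n b) ∣⁺? k) *
                         (coefficient g h m a * coefficient g h n b)) ∎

-- Zero divisors in ℝ and ℂ

0ℝ : ℝ
0ℝ = ℚ⇒ℝ 0ℚ

bounds⇒≈0 : ∀ {x} → (∀ ε → 0ℚ ℚ.< ε → ∃ λ N → ∀ n → N ℕ.≤ n → ℚ.∣ seq x n ∣ ℚ.< ε) → x ≈ℝ 0ℝ
bounds⇒≈0 {x} b = mk≈ λ ε ε>0 → let N , p = b ε ε>0 in
  N , λ n N≤n → subst (ℚ._< ε) (cong ℚ.∣_∣ (≡.sym (ℚₚ.+-identityʳ (seq x n)))) (p n N≤n)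

≈0⇒bounds : ∀ {x} → x ≈ℝ 0ℝ → ∀ ε → 0ℚ ℚ.< ε → ∃ λ N → ∀ n → N ℕ.≤ n → ℚ.∣ seq x n ∣ ℚ.< ε
≈0⇒bounds {x} (mk≈ v) ε ε>0 = let N , p = v ε ε>0 in
  N , λ n N≤n → subst (ℚ._< ε) (cong ℚ.∣_∣ (ℚₚ.+-identityʳ (seq x n))) (p n N≤n)

*-pos : ∀ {p q} → 0ℚ ℚ.< p → 0ℚ ℚ.< q → 0ℚ ℚ.< p ℚ.* q
*-pos {p} {q} p>0 q>0 = subst (ℚ._< p ℚ.* q) (ℚₚ.*-zeroʳ p) (ℚₚ.*-monoʳ-<-pos p {{positive p>0}} q>0)

½+½ : ∀ ε → ½ ℚ.* ε ℚ.+ ½ ℚ.* ε ≡ ε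
½+½ ε = ≡.trans (≡.sym (ℚₚ.*-distribʳ-+ ε ½ ½)) (ℚₚ.*-identityˡ ε)

½-pos : 0ℚ ℚ.< ½
½-pos = ℚₚ.positive⁻¹ ½

-- If ∣x n∣ ≥ ε for one n beyond the modulus of ε/2, then x is bounded away from 0, so y ≈ 0.
no-zero-divisors-ℝ : ∀ {x y} → x *ℝ y ≈ℝ 0ℝ → ¬ (y ≈ℝ 0ℝ) → x ≈ℝ 0ℝ
no-zero-divisors-ℝ {x} {y} xy≈0 y≉0 = bounds⇒≈0 λ ε ε>0 →
  let ε/2>0 = *-pos ½-pos ε>0
      N , close = cauchy x (½ ℚ.* ε) ε/2>0
  in N , λ n N≤n → small ε ε>0 ε/2>0 N close n N≤n
  where
  small : ∀ ε → 0ℚ ℚ.< ε → 0ℚ ℚ.< ½ ℚ.* ε → ∀ N →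
    (∀ m n → N ℕ.≤ m → N ℕ.≤ n → ℚ.∣ seq x m ℚ.- seq x n ∣ ℚ.< ½ ℚ.* ε) →
    ∀ n → N ℕ.≤ n → ℚ.∣ seq x n ∣ ℚ.< ε
  -- The case distinction compares rationals and is therefore decidable; no real number is tested
  -- for being zero.
  small ε ε>0 ε/2>0 N close n N≤n with ℚ.∣ seq x n ∣ ℚₚ.<? ε
  ... | yes xn<ε = xn<ε
  -- For large `m`, `∣x m∣ ≥ ε/2` and `∣x m * y m∣ < (ε/2)η`; cancelling `ε/2` gives `∣y m∣ < η`, so
  -- `y ≈ 0`, contradicting `y≉0`.
  ... | no  xn≮ε = ⊥-elim (y≉0 (bounds⇒≈0 λ η η>0 →
    let M , p = ≈0⇒bounds xy≈0 (½ ℚ.* ε ℚ.* η) (*-pos ε/2>0 η>0)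
    in N ℕ.⊔ M , λ m N⊔M≤m →
      ℚₚ.*-cancelˡ-<-nonNeg (½ ℚ.* ε) {{ℚₚ.pos⇒nonNeg (½ ℚ.* ε) {{positive ε/2>0}}}}
        (ℚₚ.≤-<-trans
          (ℚₚ.*-monoʳ-≤-nonNeg ℚ.∣ seq y m ∣ {{ℚₚ.∣-∣-nonNeg (seq y m)}} (large m (ℕₚ.m⊔n≤o⇒m≤o N M N⊔M≤m)))
          (subst (ℚ._< ½ ℚ.* ε ℚ.* η) (ℚₚ.∣p*q∣≡∣p∣*∣q∣ (seq x m) (seq y m)) (p m (ℕₚ.m⊔n≤o⇒n≤o N M N⊔M≤m))))))
    where
    large : ∀ m → N ℕ.≤ m → ½ ℚ.* ε ℚ.≤ ℚ.∣ seq x m ∣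
    large m N≤m = ℚₚ.≮⇒≥ λ xm< → xn≮ε (ℚₚ.≤-<-trans
      (subst (λ p → ℚ.∣ p ∣ ℚ.≤ ℚ.∣ seq x n ℚ.- seq x m ∣ ℚ.+ ℚ.∣ seq x m ∣)
        (solve 2 (λ a b → (a :- b) :+ b := a) refl (seq x n) (seq x m))
        (ℚₚ.∣p+q∣≤∣p∣+∣q∣ (seq x n ℚ.- seq x m) (seq x m)))
      (subst (ℚ.∣ seq x n ℚ.- seq x m ∣ ℚ.+ ℚ.∣ seq x m ∣ ℚ.<_) (½+½ ε)
        (ℚₚ.+-mono-< (close n m N≤n N≤m) xm<)))

∣_∣² : ℂ → ℝ
∣ z ∣² = re z *ℝ re z +ℝ im z *ℝ im z

-- The two-square identity, holding term by term in the representing sequences.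
∣∣²-* : ∀ z w → ∣ z ∣² *ℝ ∣ w ∣² ≈ℝ ∣ z *ℂ w ∣²
∣∣²-* z w = pointwise λ n → solve 4 (λ a b c d →
  (a :* a :+ b :* b) :* (c :* c :+ d :* d) :=
  (a :* c :- b :* d) :* (a :* c :- b :* d) :+ (a :* d :+ b :* c) :* (a :* d :+ b :* c)) refl
  (seq (re z) n) (seq (im z) n) (seq (re w) n) (seq (im w) n)

0≤p² : ∀ p → 0ℚ ℚ.≤ p ℚ.* p
0≤p² p with ℚₚ.≤-total 0ℚ p
... | inj₁ 0≤p = subst (ℚ._≤ p ℚ.* p) (ℚₚ.*-zeroʳ p) (ℚₚ.*-monoˡ-≤-nonNeg p {{nonNegative 0≤p}} 0≤p)
... | inj₂ p≤0 = subst (ℚ._≤ p ℚ.* p) (ℚₚ.*-zeroʳ p) (ℚₚ.*-monoˡ-≤-nonPos p {{nonPositive p≤0}} p≤0)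

p²<ε²⇒∣p∣<ε : ∀ p ε → 0ℚ ℚ.< ε → p ℚ.* p ℚ.< ε ℚ.* ε → ℚ.∣ p ∣ ℚ.< ε
p²<ε²⇒∣p∣<ε p ε ε>0 p²<ε² = ℚₚ.≰⇒> λ ε≤p → ℚₚ.<-irrefl refl (ℚₚ.<-≤-trans p²<ε² (ℚₚ.≤-trans
  (ℚₚ.*-monoˡ-≤-nonNeg ε {{nonNegative (ℚₚ.<⇒≤ ε>0)}} ε≤p)
  (ℚₚ.≤-trans (ℚₚ.*-monoʳ-≤-nonNeg ℚ.∣ p ∣ {{ℚₚ.∣-∣-nonNeg p}} ε≤p)
    (ℚₚ.≤-reflexive (≡.trans (≡.sym (ℚₚ.∣p*q∣≡∣p∣*∣q∣ p p)) (ℚₚ.0≤p⇒∣p∣≡p (0≤p² p)))))))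

-- As `x² ≤ x² + y²`, bounding the sum by `ε²` bounds `∣x∣` by `ε`.
sum-of-squares≈0 : ∀ x y → x *ℝ x +ℝ y *ℝ y ≈ℝ 0ℝ → x ≈ℝ 0ℝ
sum-of-squares≈0 x y x²+y²≈0 = bounds⇒≈0 λ ε ε>0 →
  let N , p = ≈0⇒bounds x²+y²≈0 (ε ℚ.* ε) (*-pos ε>0 ε>0)
  in N , λ n N≤n → p²<ε²⇒∣p∣<ε (seq x n) ε ε>0 (ℚₚ.≤-<-trans (≤∣p+q∣ (0≤p² (seq x n)) (0≤p² (seq y n))) (p n N≤n))
  where
  ≤∣p+q∣ : ∀ {p q} → 0ℚ ℚ.≤ p → 0ℚ ℚ.≤ q → p ℚ.≤ ℚ.∣ p ℚ.+ q ∣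
  ≤∣p+q∣ {p} {q} 0≤p 0≤q = ℚₚ.≤-trans
    (subst (ℚ._≤ p ℚ.+ q) (ℚₚ.+-identityʳ p) (ℚₚ.+-monoʳ-≤ p 0≤q))
    (ℚₚ.≤-reflexive (≡.sym (ℚₚ.0≤p⇒∣p∣≡p (ℚₚ.+-mono-≤ 0≤p 0≤q))))

∣z∣²≈0⇒z≈0 : ∀ {z} → ∣ z ∣² ≈ℝ 0ℝ → z ≈ 0#
∣z∣²≈0⇒z≈0 {z} p = mk≈ (sum-of-squares≈0 (re z) (im z) p)
  (sum-of-squares≈0 (im z) (re z) (≈ℝ-trans (pointwise λ n → ℚₚ.+-comm _ (seq (re z) n ℚ.* seq (re z) n)) p))

∣∣²-cong : ∀ {z w} → z ≈ w → ∣ z ∣² ≈ℝ ∣ w ∣²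
∣∣²-cong (mk≈ p q) = +ℝ-cong (*ℝ-cong p p) (*ℝ-cong q q)

-- Squared moduli reduce the claim to real numbers. The hypothesis on `w` is a plain negation, which
-- is what the negative `notAllZero` can provide.
no-zero-divisors : ∀ {z w} → z * w ≈ 0# → ¬ (w ≈ 0#) → z ≈ 0#
no-zero-divisors {z} {w} zw≈0 w≉0 = ∣z∣²≈0⇒z≈0
  (no-zero-divisors-ℝ {∣ z ∣²} {∣ w ∣²}
    (≈ℝ-trans (∣∣²-* z w) (≈ℝ-trans (∣∣²-cong zw≈0) (pointwise λ _ → refl)))
    (w≉0 ∘ ∣z∣²≈0⇒z≈0))

-- Nonvanishing of the average

-- Otherwise `g(n) = g(1)g(n)` would vanish for every `n`.
multiplicative-1≉0 : ∀ g → IsMultiplicative₁ g → ¬ (g 1⁺ ≈ 0#)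
multiplicative-1≉0 g g-mult g1≈0 = IsMultiplicative.notAllZero g-mult λ n → begin
  g (n zero)          ≡⟨ cong g (≡⁺ (ℕₚ.*-identityˡ (value (n zero)))) ⟨
  g (1⁺ *⁺ n zero)    ≈⟨ multiplicative-coprime g g-mult 1⁺ (n zero) (Coprime.1-coprimeTo (value (n zero))) ⟩
  g 1⁺ * g (n zero)   ≈⟨ *-congʳ g1≈0 ⟩
  0# * g (n zero)     ≈⟨ zeroˡ (g (n zero)) ⟩
  0#                  ∎

multiplicative-1-idem : ∀ g → IsMultiplicative₁ g → g 1⁺ * g 1⁺ ≈ g 1⁺
multiplicative-1-idem g g-mult = sym (multiplicative-coprime g g-mult 1⁺ 1⁺ (Coprime.1-coprimeTo 1))

Lcm-1 : ∀ r → Lcm {r} (const 1⁺) ≡ 1⁺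
Lcm-1 ℕ.zero    = refl
Lcm-1 (ℕ.suc r) = cong (lcm⁺ 1⁺) (Lcm-1 r)

-- At `(1,…,1)` only `k = 1` occurs and every factor is `g(1)h(1)`. This is idempotent, so the
-- product of `r ≥ 1` copies collapses to one.
average-1 : ∀ g h → IsMultiplicative₁ g → IsMultiplicative₁ h → ∀ r .{{_ : NonZero r}} →
  average (ramanujan g h) {r} (const 1⁺) ≈ g 1⁺ * h 1⁺
average-1 g h g-mult h-mult r = begin
  average f {r} (const 1⁺)          ≈⟨ average-over-1 (Lcm-1 r) ⟩
  ∏ {r} (const (f 1⁺ 1⁺))           ≈⟨ ∏-cong {r} (λ _ → +-identityʳ (g 1⁺ * h 1⁺)) ⟩
  ∏ {r} (const (g 1⁺ * h 1⁺))       ≈⟨ Π.sum-replicate-idem idem r ⟩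
  g 1⁺ * h 1⁺                       ∎
  where
  f = ramanujan g h

  -- `Lcm {r} (const 1⁺)` does not reduce for a variable `r`; the range is generalised to `n` so
  -- that `refl` can be matched.
  average-over-1 : ∀ {n} → n ≡ 1⁺ → 1/ n * ∑ (1… n) (λ k → ∏ {r} λ _ → f k 1⁺) ≈ ∏ {r} (const (f 1⁺ 1⁺))
  average-over-1 refl = trans (*-identityˡ _) (+-identityʳ _)

  idem : g 1⁺ * h 1⁺ * (g 1⁺ * h 1⁺) ≈ g 1⁺ * h 1⁺
  idem = trans (*.interchange _ _ _ _)
    (*-cong (multiplicative-1-idem g g-mult) (multiplicative-1-idem h h-mult))

proposition19 :
  (g h : ℕ⁺ → ℂ) (r : ℕ) .{{_ : NonZero r}} →
  let f   = ramanujan g h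
      F_f = average f
  in
    ((m : Fin r → ℕ⁺) →
      (F_f m ≈ ∑ (divisorTuples m) (λ d →
                 (∏ (λ i → g (proj₁ (d i))) * 1/ Lcm (λ i → proj₁ (d i)))
                   * ∏ (λ i → h (m i / proj₁ (d i) ⟨ proj₂ (d i) ⟩)))) ×
      (F_f m ≈ 1/ Lcm m * ∑ (divisors (Lcm m)) (λ (d , d∣m) →
                 ∏ (λ i → f d (m i)) * ℕ⇒ℂ (φ (Lcm m / d ⟨ d∣m ⟩)))))
  × (IsMultiplicative₁ g → IsMultiplicative₁ h →
       IsMultiplicative {r} (λ m → F_f m))
proposition19 g h r =
    (λ m → trans (average-divisorTuples g h m)
                 (∑-cong (divisorTuples m) λ d → *.xy∙z≈xz∙y _ _ _)
         , average-divisors g h m)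
  , λ g-mult h-mult → record
    -- If the average vanished everywhere, then so would its value `g(1)h(1)` at `(1,…,1)`; since
    -- `h(1)` is not 0, `g(1)` would be 0.
    { notAllZero = λ F≈0 → multiplicative-1≉0 g g-mult (no-zero-divisors
        (trans (sym (average-1 g h g-mult h-mult r)) (F≈0 (const 1⁺)))
        (multiplicative-1≉0 h h-mult))
    ; homo = average-* g h g-mult h-mult
    }
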